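{- Let $t$ and $m \geq 2$ be integers with $t \geq m$, and let $\mathcal{H}$ be a family of connected $m$-uniform hypergraphs each having more than $t$ vertices. Then, as $r \to \infty$, \[ f_m(r, \mathcal{H}) \leq (1 + o_r(1))\, \frac{\binom{r-1}{m-1}}{\binom{t-1}{m-1}}. \]
   Context: Let $r \ge m \ge 2$ and $k$ be positive integers. An $m$-uniform hypergraph $G$ is an $(r,k)$-hypergraph if $V(G)$ can be partitioned into sets $V_1,\dots,V_r$ with $|V_i| \le k$ for all $i$ such that for every $m$-element subset $\{i_1,\dots,i_m\}$ of $[r]$ there is an edge $e \in E(G)$ with $|e \cap V_{i_j}| = 1$ for $1 \le j \le m$. For a family $\mathcal{H}$ of $m$-uniform hypergraphs, $f_m(r,\mathcal{H})$ is the minimum $k$ such that there exists an $m$-uniform $(r,k)$-hypergraph containing no member of $\mathcal{H}$ as a subgraph. $o_r(1)$ denotes a quantity tending to $0$ as $r \to \infty$. -}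

module Defs where

open import Data.Nat using (ℕ; _≤_; _<_)
open import Data.Fin using (Fin; _≟_)
open import Data.Fin.Subset using (Subset; _∈_; ∣_∣; _∩_)
open import Data.Vec using (tabulate)
open import Data.Product using (Σ; ∃; _×_)
open import Relation.Nullary using (¬_; does)
open import Relation.Binary.PropositionalEquality using (_≡_)
open import Relation.Binary.Construct.Closure.ReflexiveTransitive using (Star)
open import Function.Definitions using (Injective)

record Hypergraph (m : ℕ) : Set₁ where
  field
    nV      : ℕ
    Edge    : Subset nV → Set
    uniform : ∀ e → Edge e → ∣ e ∣ ≡ m
open Hypergraph public

Adj : ∀ {m} (H : Hypergraph m) → Fin (nV H) → Fin (nV H) → Set
Adj H u v = ∃ λ e → Edge H e × u ∈ e × v ∈ e

Connected : ∀ {m} → Hypergraph m → Set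
Connected H = ∀ u v → Star (Adj H) u v

_⊆H_ : ∀ {m} → Hypergraph m → Hypergraph m → Set
F ⊆H G = ∃ λ (φ : Fin (nV F) → Fin (nV G)) → Injective _≡_ _≡_ φ ×
  (∀ e → Edge F e → ∃ λ e' → Edge G e' ×
      (∀ w → (w ∈ e' → ∃ λ v → v ∈ e × φ v ≡ w) × ((∃ λ v → v ∈ e × φ v ≡ w) → w ∈ e')))

fiber : ∀ {n r} → (Fin n → Fin r) → Fin r → Subset n
fiber part i = tabulate (λ v → does (part v ≟ i))

IsRK : ∀ {m} → ℕ → ℕ → Hypergraph m → Set
IsRK {m} r k G = ∃ λ (part : Fin (nV G) → Fin r) →
  (∀ i → ∣ fiber part i ∣ ≤ k) ×
  (∀ (S : Subset r) → ∣ S ∣ ≡ m → ∃ λ e → Edge G e ×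
      (∀ i → i ∈ S → ∣ e ∩ fiber part i ∣ ≡ 1))

Free : ∀ {m} → (Hypergraph m → Set) → Hypergraph m → Set₁
Free {m} 𝓗 G = ∀ (F : Hypergraph m) → 𝓗 F → ¬ (F ⊆H G)

{-# OPTIONS --safe #-}
-- The points are the pairs of a group i < n and a word over ℤ/N, one letter for each ε in the cube {0,1}^n
-- and one more. A block consists of a t-set T of groups and, for each ε, a polynomial of degree < m: it
-- contains, in each group i of T, the word of the values at the node 2i + ε i, shifted by a fixed word g_T(i).
-- Prescribing an m-set of points in distinct groups S ⊂ T prescribes all the polynomials, and the sum of
-- their top coefficients is a sum κ_S of divided differences. The shifts are chosen such that κ_S(g_T) is
-- the rank of T among the lam = C(n-m, t-m) t-sets that contain S; only the polynomials whose top
-- coefficients add up to a multiple of lam are allowed. So κ_S modulo lam tells which T to use, and the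
-- blocks cover each such m-set essentially once. The m-sets meeting a group twice are few when n is large;
-- each becomes a block of its own. The hypergraph is the disjoint union of the complete m-graphs on the
-- blocks, with a vertex for every pair of a block and a point on it, and its components have at most t vertices.
module Submission where

open import Defs
open import Data.Nat using (ℕ; zero; suc; _≤_; _<_; _*_; _+_; _∸_; _^_; _/_; _%_; _!; z≤n; s≤s; NonZero)
import Data.Nat as ℕ
import Data.Nat.Properties as ℕₚ
import Data.Nat.DivMod as ℕᵈ
import Data.Nat.Tactic.RingSolver as ℕSolver
open import Data.Nat.Combinatorics using (_C_; nCk+nC[k+1]≡[n+1]C[k+1]; nCk≡n!/k![n-k]!; k![n∸k]!∣n!; nCn≡1)
open import Data.Nat.Divisibility using (∣-trans; m∣m*n; m≤n⇒m!∣n!)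
open import Data.Integer using (ℤ; +_; -[1+_]; 0ℤ; 1ℤ; _-_; -_) renaming (_+_ to _+ᶻ_; _*_ to _*ᶻ_)
import Data.Integer as Int
import Data.Integer.Properties as ℤₚ
import Data.Integer.DivMod as ℤᵈ
open import Data.Integer.Tactic.RingSolver using (solve-∀)
open import Data.Bool using (Bool; true; false)
open import Data.Fin as Fin using (Fin; zero; suc; toℕ)
import Data.Fin.Properties as Finₚ
open import Data.Fin.Subset using (Subset; _∈_; _∉_; _⊆_; ∣_∣; _∩_; ⁅_⁆; ⊥)
import Data.Fin.Subset.Properties as Subₚ
open import Data.Vec using (Vec; []; _∷_; tabulate; lookup; here; there; head; tail; insertAt; removeAt; map)
import Data.Vec.Properties as Vecₚ
open import Data.Product using (Σ; ∃; _×_; _,_; proj₁; proj₂)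
open import Data.Product.Properties using (,-injective; ≡-dec)
open import Data.Sum using (_⊎_; inj₁; inj₂)
open import Data.Sum.Properties using (inj₁-injective; inj₂-injective)
open import Data.Empty using (⊥-elim)
open import Relation.Nullary using (¬_; Dec; yes; no; does; ¬?; _×-dec_)
open import Relation.Nullary.Decidable using (dec-true)
open import Relation.Binary using (Setoid; DecidableEquality)
open import Relation.Binary.PropositionalEquality
import Relation.Binary.Reasoning.Setoid as SetoidReasoning
open import Relation.Binary.Construct.Closure.ReflexiveTransitive using (Star; _◅_) renaming (ε to stop)
open import Function using (_∘_; id; Injective)

-- Finite sets and encodings

infix 4 _↪_
_↪_ : Set → ℕ → Set
A ↪ k = Σ (A → Fin k) (Injective _≡_ _≡_)

fin↪ : ∀ {n} → Fin n ↪ n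
fin↪ = id , id

infixr 3 _×↪_
_×↪_ : ∀ {A B a b} → A ↪ a → B ↪ b → (A × B) ↪ (a * b)
(f , fi) ×↪ (g , gi) = (λ (x , y) → Fin.combine (f x) (g y)) , λ {(x , y)} {(x' , y')} eq →
  let p , q = Finₚ.combine-injective (f x) (g y) (f x') (g y') eq in cong₂ _,_ (fi p) (gi q)

infixr 2 _⊎↪_
_⊎↪_ : ∀ {A B a b} → A ↪ a → B ↪ b → (A ⊎ B) ↪ (a + b)
_⊎↪_ {A} {B} {a} {b} (f , fi) (g , gi) = h , hi
  where
  h : A ⊎ B → Fin (a + b)
  h (inj₁ x) = f x Fin.↑ˡ b
  h (inj₂ y) = a Fin.↑ʳ g y
  hi : Injective _≡_ _≡_ h
  hi {inj₁ x} {inj₁ y} eq = cong inj₁ (fi (Finₚ.↑ˡ-injective b _ _ eq))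
  hi {inj₂ x} {inj₂ y} eq = cong inj₂ (gi (Finₚ.↑ʳ-injective a _ _ eq))
  hi {inj₁ x} {inj₂ y} eq with trans (sym (Finₚ.splitAt-↑ˡ a (f x) b)) (trans (cong (Fin.splitAt a) eq) (Finₚ.splitAt-↑ʳ a b (g y)))
  ... | ()
  hi {inj₂ x} {inj₁ y} eq with trans (sym (Finₚ.splitAt-↑ʳ a b (g x))) (trans (cong (Fin.splitAt a) eq) (Finₚ.splitAt-↑ˡ a (f y) b))
  ... | ()

vec↪ : ∀ {A a} → A ↪ a → ∀ n → Vec A n ↪ (a ^ n)
vec↪ e zero = (λ _ → zero) , λ { {[]} {[]} _ → refl }
vec↪ e (suc n) = let f , fi = e ×↪ vec↪ e n in
  (λ { (x ∷ xs) → f (x , xs) }) ,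
  λ { {x ∷ xs} {y ∷ ys} eq → let p , q = ,-injective (fi eq) in cong₂ _∷_ p q }

enumerate : ∀ {n} (s : Subset n) → Σ (Fin ∣ s ∣ → Fin n) λ e → Injective _≡_ _≡_ e ×
  (∀ j → e j ∈ s) × (∀ {i} → i ∈ s → ∃ λ j → e j ≡ i)
enumerate [] = (λ ()) , (λ { {()} }) , (λ ()) , λ ()
enumerate (true ∷ s) with enumerate s
... | e , inj , mem , sur = e' , inj' , mem' , sur'
  where
  e' : Fin (suc ∣ s ∣) → Fin _
  e' zero = zero
  e' (suc j) = suc (e j)
  inj' : Injective _≡_ _≡_ e'
  inj' {zero} {zero} eq = refl
  inj' {suc i} {suc j} eq = cong suc (inj (Finₚ.suc-injective eq))
  mem' : ∀ j → e' j ∈ true ∷ s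
  mem' zero = here
  mem' (suc j) = there (mem j)
  sur' : ∀ {i} → i ∈ true ∷ s → ∃ λ j → e' j ≡ i
  sur' here = zero , refl
  sur' (there p) = let j , q = sur p in suc j , cong suc q
enumerate (false ∷ s) with enumerate s
... | e , inj , mem , sur = suc ∘ e , inj ∘ Finₚ.suc-injective , there ∘ mem ,
  λ { (there p) → let j , q = sur p in j , cong suc q }

∣∣≤ : ∀ {n k} (s : Subset n) (h : Fin n → Fin k) →
  (∀ {i j} → i ∈ s → j ∈ s → h i ≡ h j → i ≡ j) → ∣ s ∣ ≤ k
∣∣≤ s h inj with enumerate s
... | e , ei , mem , _ = Finₚ.injective⇒≤ {f = h ∘ e} λ eq → ei (inj (mem _) (mem _) eq)

∣∣≡ : ∀ {n k} (s : Subset n) (e : Fin k → Fin n) → Injective _≡_ _≡_ e →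
  (∀ j → e j ∈ s) → (∀ {i} → i ∈ s → ∃ λ j → e j ≡ i) → ∣ s ∣ ≡ k
∣∣≡ s e ei mem sur with enumerate s
... | f , fi , fmem , fsur = ℕₚ.≤-antisym
  (Finₚ.injective⇒≤ {f = λ j → proj₁ (sur (fmem j))} λ {i} {j} eq →
    fi (trans (sym (proj₂ (sur (fmem i)))) (trans (cong e eq) (proj₂ (sur (fmem j))))))
  (Finₚ.injective⇒≤ {f = λ j → proj₁ (fsur (mem j))} λ {i} {j} eq →
    ei (trans (sym (proj₂ (fsur (mem i)))) (trans (cong f eq) (proj₂ (fsur (mem j))))))

module _ {n} {P : Fin n → Set} (P? : ∀ i → Dec (P i)) where

  subset : Subset n
  subset = tabulate (λ i → does (P? i))

  ∈-subset⁺ : ∀ {i} → P i → i ∈ subset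
  ∈-subset⁺ {i} p = Vecₚ.lookup⇒[]= i subset
    (trans (Vecₚ.lookup∘tabulate _ i) (dec-true (P? i) p))

  ∈-subset⁻ : ∀ {i} → i ∈ subset → P i
  ∈-subset⁻ {i} q with P? i | trans (sym (Vecₚ.lookup∘tabulate (λ j → does (P? j)) i)) (Vecₚ.[]=⇒lookup q)
  ... | yes p | _ = p
  ... | no _ | ()

image : ∀ {m n} → (Fin m → Fin n) → Subset n
image e = subset λ i → Finₚ.any? λ j → e j Fin.≟ i

∈-image⁺ : ∀ {m n} (e : Fin m → Fin n) j → e j ∈ image e
∈-image⁺ e j = ∈-subset⁺ (λ i → Finₚ.any? λ j → e j Fin.≟ i) (j , refl)

∈-image⁻ : ∀ {m n} (e : Fin m → Fin n) {i} → i ∈ image e → ∃ λ j → e j ≡ i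
∈-image⁻ e = ∈-subset⁻ (λ i → Finₚ.any? λ j → e j Fin.≟ i)

∣image∣ : ∀ {m n} (e : Fin m → Fin n) → Injective _≡_ _≡_ e → ∣ image e ∣ ≡ m
∣image∣ e inj = ∣∣≡ (image e) e inj (∈-image⁺ e) (∈-image⁻ e)

-- Block systems and their hypergraphs

-- A family of blocks of at most t points each (idx embeds a block into Fin t) in which the blocks
-- through a common point are told apart by their codes.
record Blocks (X : Set) (t : ℕ) (Code : Set) : Set₁ where
  field
    Block    : Set
    Mem      : Block → X → Set
    code     : ∀ {b x} → Mem b x → Code
    code-irr : ∀ {b x} (p q : Mem b x) → code p ≡ code q
    code-inj : ∀ {b b' x} (p : Mem b x) (q : Mem b' x) → code p ≡ code q → b ≡ b'
    idx      : ∀ {b x} → Mem b x → Fin t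
    idx-inj  : ∀ {b x y} (p : Mem b x) (q : Mem b y) → idx p ≡ idx q → x ≡ y

  Covers : ∀ {m} → (Fin m → X) → Set
  Covers e = ∃ λ b → ∀ j → Mem b (e j)
open Blocks using (Covers)

restrict : ∀ {X Y t C} (f : Y → X) → Injective _≡_ _≡_ f → Blocks X t C → Blocks Y t C
restrict f fi 𝓑 = record
  { Block = Block ; Mem = λ b y → Mem b (f y) ; code = code ; code-irr = code-irr
  ; code-inj = code-inj ; idx = idx ; idx-inj = λ p q eq → fi (idx-inj p q eq) }
  where open Blocks 𝓑

_∪ᴮ_ : ∀ {X t C D} → Blocks X t C → Blocks X t D → Blocks X t (C ⊎ D)
𝓑 ∪ᴮ 𝓓 = record
  { Block = 𝓑.Block ⊎ 𝓓.Block
  ; Mem = λ { (inj₁ b) → 𝓑.Mem b ; (inj₂ b) → 𝓓.Mem b }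
  ; code = λ { {inj₁ b} p → inj₁ (𝓑.code p) ; {inj₂ b} p → inj₂ (𝓓.code p) }
  ; code-irr = λ { {inj₁ b} p q → cong inj₁ (𝓑.code-irr p q) ; {inj₂ b} p q → cong inj₂ (𝓓.code-irr p q) }
  ; code-inj = λ { {inj₁ b} {inj₁ b'} p q eq → cong inj₁ (𝓑.code-inj p q (inj₁-injective eq))
                 ; {inj₂ b} {inj₂ b'} p q eq → cong inj₂ (𝓓.code-inj p q (inj₂-injective eq))
                 ; {inj₁ b} {inj₂ b'} p q () ; {inj₂ b} {inj₁ b'} p q () }
  ; idx = λ { {inj₁ b} → 𝓑.idx ; {inj₂ b} → 𝓓.idx }
  ; idx-inj = λ { {inj₁ b} → 𝓑.idx-inj ; {inj₂ b} → 𝓓.idx-inj } }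
  where module 𝓑 = Blocks 𝓑
        module 𝓓 = Blocks 𝓓

module _ {r t m k : ℕ} {C : Set} (2≤m : 2 ≤ m) (m≤t : m ≤ t) (enc : C ↪ k) (𝓑 : Blocks (Fin r) t C)
  (covers : ∀ (e : Fin m → Fin r) → Injective _≡_ _≡_ e → Covers 𝓑 e) where
  open Blocks 𝓑 hiding (Covers)

  private
    part : Fin (r * k) → Fin r
    part v = proj₁ (Fin.remQuot {r} k v)

    slot : Fin (r * k) → Fin k
    slot v = proj₂ (Fin.remQuot {r} k v)

    part-slot-inj : ∀ {v w} → part v ≡ part w → slot v ≡ slot w → v ≡ w
    part-slot-inj {v} {w} p q = trans (sym (Finₚ.combine-remQuot {r} k v))
      (trans (cong₂ Fin.combine p q) (Finₚ.combine-remQuot {r} k w))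

    At : Block → Fin (r * k) → Set
    At b v = Σ (Mem b (part v)) λ p → slot v ≡ proj₁ enc (code p)

    -- The pair `v` is general so that the equation can be matched with `refl`: splitting a combined
    -- index gives the pair back only propositionally, and the type of the membership depends on its
    -- first component.
    slot-code : ∀ {b x} (p : Mem b x) {v : Fin r × Fin k} → v ≡ (x , proj₁ enc (code p)) →
      Σ (Mem b (proj₁ v)) λ q → proj₂ v ≡ proj₁ enc (code q)
    slot-code p refl = p , refl

    At-block : ∀ {b b' v} → At b v → At b' v → b ≡ b'
    At-block (p , p') (q , q') = code-inj p q (proj₂ enc (trans (sym p') q'))

    At-vertex : ∀ {b v w} → At b v → At b w → part v ≡ part w → v ≡ w
    At-vertex {b} {v} {w} (p , p') (q , q') eq =
      part-slot-inj eq (trans p' (trans (cong (proj₁ enc) (irr eq p q)) (sym q')))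
      where
      irr : ∀ {x y} → x ≡ y → (p : Mem b x) (q : Mem b y) → code p ≡ code q
      irr refl p q = code-irr p q

  -- A vertex is a point with a slot, and it lies on `b` when the slot encodes the code of `b` at
  -- that point. By `code-inj` no vertex lies on two blocks; slots that encode nothing give isolated
  -- vertices.
  blockGraph : Hypergraph m
  blockGraph = record
    { nV = r * k
    ; Edge = λ e → ∣ e ∣ ≡ m × ∃ λ b → ∀ {v} → v ∈ e → At b v
    ; uniform = λ _ → proj₁ }

  blockGraph-IsRK : IsRK r k blockGraph
  blockGraph-IsRK = part , fiber≤ , edges
    where
    fiber≤ : ∀ i → ∣ fiber part i ∣ ≤ k
    fiber≤ i = ∣∣≤ (fiber part i) slot λ p q eq →
      part-slot-inj (trans (∈-subset⁻ (λ w → part w Fin.≟ i) p) (sym (∈-subset⁻ (λ w → part w Fin.≟ i) q))) eq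

    edges : ∀ (S : Subset r) → ∣ S ∣ ≡ m → ∃ λ e → Edge blockGraph e ×
      (∀ i → i ∈ S → ∣ e ∩ fiber part i ∣ ≡ 1)
    edges S refl with enumerate S
    ... | e , ei , _ , sur with covers e ei
    ... | b , mem = image φ , (∣image∣ φ φ-inj , b , at) , one
      where
      φ : Fin m → Fin (r * k)
      φ j = Fin.combine (e j) (proj₁ enc (code (mem j)))
      part-φ : ∀ j → part (φ j) ≡ e j
      part-φ j = cong proj₁ (Finₚ.remQuot-combine {r} {k} (e j) _)
      φ-inj : Injective _≡_ _≡_ φ
      φ-inj {i} {j} eq = ei (trans (sym (part-φ i)) (trans (cong part eq) (part-φ j)))
      At-φ : ∀ j → At b (φ j)
      At-φ j = slot-code (mem j) (Finₚ.remQuot-combine {r} {k} (e j) _)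
      at : ∀ {v} → v ∈ image φ → At b v
      at v∈ with ∈-image⁻ φ v∈
      ... | j , refl = At-φ j
      one : ∀ i → i ∈ S → ∣ image φ ∩ fiber part i ∣ ≡ 1
      one i i∈S with sur i∈S
      ... | j , refl = ∣∣≡ _ (λ _ → φ j) (λ { {zero} {zero} _ → refl })
        (λ _ → Subₚ.x∈p∩q⁺ (∈-image⁺ φ j , ∈-subset⁺ (λ w → part w Fin.≟ i) (part-φ j)))
        λ {v} v∈ → let a , b = Subₚ.x∈p∩q⁻ (image φ) (fiber part i) v∈ in zero , sym (only v a (∈-subset⁻ (λ w → part w Fin.≟ i) b))
        where
        only : ∀ v → v ∈ image φ → part v ≡ e j → v ≡ φ j
        only v a q with ∈-image⁻ φ a
        ... | j' , refl = cong φ (ei (trans (sym (part-φ j')) q))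

  -- Adjacent vertices of `F` have images on a common block, and a vertex lies on at most one block.
  -- So connectedness puts the whole image on one block, which `idx` embeds into `Fin t`.
  blockGraph-Free : (𝓗 : Hypergraph m → Set) → (∀ F → 𝓗 F → Connected F × t < nV F) → Free 𝓗 blockGraph
  blockGraph-Free 𝓗 big F F∈ (φ , φ-inj , edge) with big F F∈
  ... | conn , t<n = ℕₚ.<⇒≱ t<n (Finₚ.injective⇒≤ {f = λ v → idx (proj₁ (in-b v))} λ {v} {w} eq →
        φ-inj (At-vertex (in-b v) (in-b w) (idx-inj _ _ eq)))
    where
    edge-block : ∀ {u v} → Adj F u v → ∃ λ b → At b (φ u) × At b (φ v)
    edge-block (e , e∈ , u∈ , v∈) with edge e e∈
    ... | e' , (_ , b , at) , eq = b , at (proj₂ (eq _) (_ , u∈ , refl)) , at (proj₂ (eq _) (_ , v∈ , refl))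

    2≤n : 2 ≤ nV F
    2≤n = ℕₚ.≤-trans 2≤m (ℕₚ.≤-trans m≤t (ℕₚ.<⇒≤ t<n))

    v₀ v₁ : Fin (nV F)
    v₀ = Fin.fromℕ< {0} (ℕₚ.<-trans (s≤s z≤n) 2≤n)
    v₁ = Fin.fromℕ< {1} 2≤n

    v₀≢v₁ : v₀ ≢ v₁
    v₀≢v₁ eq with trans (sym (Finₚ.toℕ-fromℕ< (ℕₚ.<-trans (s≤s z≤n) 2≤n))) (trans (cong toℕ eq) (Finₚ.toℕ-fromℕ< 2≤n))
    ... | ()

    -- The image of a vertex lies on a block once the vertex is in an edge; the first step of a walk
    -- to a second vertex supplies that edge.
    start : ∀ {w} → Star (Adj F) v₀ w → v₀ ≢ w → ∃ λ b → At b (φ v₀)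
    start stop neq = ⊥-elim (neq refl)
    start (a ◅ _) _ = let b , p , _ = edge-block a in b , p

    b₀ : Block
    b₀ = proj₁ (start (conn v₀ v₁) v₀≢v₁)

    walk : ∀ {u v} → Star (Adj F) u v → At b₀ (φ u) → At b₀ (φ v)
    walk stop p = p
    walk (a ◅ as) p with edge-block a
    ... | b , q , q' with At-block p q
    ... | refl = walk as q'

    in-b : ∀ v → At b₀ (φ v)
    in-b v = walk (conn v₀ v) (proj₂ (start (conn v₀ v₁) v₀≢v₁))

removeAt-inj : ∀ {A : Set} {n} (xs ys : Vec A (suc n)) i →
  lookup xs i ≡ lookup ys i → removeAt xs i ≡ removeAt ys i → xs ≡ ys
removeAt-inj xs ys i p q = trans (sym (Vecₚ.insertAt-removeAt xs i))
  (trans (cong₂ (λ zs → insertAt zs i) q p) (Vecₚ.insertAt-removeAt ys i))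

-- The blocks for the m-sets that meet a group twice; (p , y) stands for the points of p and the point
-- (group of head p , y). The last point costs no factor n.
module Bent {n : ℕ} {Y : Set} (_≟Y_ : DecidableEquality Y) {t m'} (m≤t : suc (suc m') ≤ t) where

  X : Set
  X = Fin n × Y

  BentBlock : Set
  BentBlock = Vec X (suc m') × Y

  BentMem : BentBlock → X → Set
  BentMem (p , y) x = (∃ λ a → lookup p a ≡ x) ⊎ (x ≡ (proj₁ (head p) , y))

  -- At an entry of `p`, the point restores that entry. At the last point, it restores `y` and the
  -- group of `head p`. In both cases only m - 2 groups remain to be recorded, against m - 1 for a
  -- generic m-set through a point.
  BentCode : Set
  BentCode = (Fin (suc m') × Vec X m' × Y) ⊎ (Vec X m' × Y)

  locate : ∀ (p : Vec X (suc m')) x → Dec (∃ λ a → lookup p a ≡ x)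
  locate p x = Finₚ.any? λ a → ≡-dec Fin._≟_ _≟Y_ (lookup p a) x

  -- Entries of `p` may repeat or equal the last point. Searching for `x`, instead of reading the
  -- position off the membership proof, makes the code independent of that proof.
  bentCode : BentBlock → X → BentCode
  bentCode (p , y) x with locate p x
  ... | yes (a , _) = inj₁ (a , removeAt p a , y)
  ... | no _ = inj₂ (tail p , proj₂ (head p))

  bentCode-inj : ∀ b b' x → BentMem b x → BentMem b' x → bentCode b x ≡ bentCode b' x → b ≡ b'
  bentCode-inj (p , y) (q , z) x u v eq with locate p x | locate q x
  bentCode-inj (p , y) (q , z) x u v eq | yes (a , r) | yes (a' , r') with ,-injective (inj₁-injective eq)
  ... | refl , eq' with ,-injective eq'
  ... | pq , refl = cong (_, y) (removeAt-inj p q a (trans r (sym r')) pq)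
  bentCode-inj (p , y) (q , z) x (inj₁ u) v eq | no k | no l = ⊥-elim (k u)
  bentCode-inj (p , y) (q , z) x (inj₂ u) (inj₁ v) eq | no k | no l = ⊥-elim (l v)
  bentCode-inj (x₀ ∷ p , y) (y₀ ∷ q , z) x (inj₂ refl) (inj₂ v) eq | no k | no l
    with ,-injective (inj₂-injective eq) | ,-injective v
  ... | refl , eq₂ | eq₁ , refl = cong (λ w → w ∷ p , y) (cong₂ _,_ eq₁ eq₂)
  bentCode-inj (p , y) (q , z) x u v () | yes _ | no _
  bentCode-inj (p , y) (q , z) x u v () | no _ | yes _

  bentBlocks : Blocks X t BentCode
  bentBlocks = record
    { Block = BentBlock ; Mem = BentMem
    ; code = λ {b} {x} _ → bentCode b x
    ; code-irr = λ _ _ → refl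
    ; code-inj = λ {b} {b'} {x} → bentCode-inj b b' x
    ; idx = λ {b} {x} p → Fin.inject≤ (bentIdx b x p) m≤t
    ; idx-inj = λ {b} {x} {y} p q eq → bentIdx-inj b x y p q (Finₚ.inject≤-injective m≤t m≤t _ _ eq) }
    where
    bentIdx : ∀ b x → BentMem b x → Fin (suc (suc m'))
    bentIdx b x (inj₁ (a , _)) = suc a
    bentIdx b x (inj₂ _) = zero
    bentIdx-inj : ∀ b x y (p : BentMem b x) (q : BentMem b y) → bentIdx b x p ≡ bentIdx b y q → x ≡ y
    bentIdx-inj b x y (inj₁ (a , p)) (inj₁ (a , q)) refl = trans (sym p) q
    bentIdx-inj b x y (inj₂ p) (inj₂ q) _ = trans p (sym q)

  -- `e a` becomes the head and `e b` the last point, which is legitimate because they share a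
  -- group; the other points fill the tail.
  bentCovers : ∀ (e : Fin (suc (suc m')) → X) a b → a ≢ b → proj₁ (e a) ≡ proj₁ (e b) → Covers bentBlocks e
  bentCovers e a b a≢b eq = (e a ∷ tabulate rest , proj₂ (e b)) , mem
    where
    a' = Fin.punchOut (a≢b ∘ sym)
    rest : Fin m' → X
    rest j = e (Fin.punchIn b (Fin.punchIn a' j))
    mem : ∀ j → BentMem (e a ∷ tabulate rest , proj₂ (e b)) (e j)
    mem j with b Fin.≟ j
    ... | yes refl = inj₂ (cong (_, proj₂ (e b)) (sym eq))
    ... | no b≢j with a' Fin.≟ Fin.punchOut b≢j
    ... | yes q = inj₁ (zero , cong e (Finₚ.punchOut-injective (a≢b ∘ sym) b≢j q))
    ... | no a'≢ = inj₁ (suc (Fin.punchOut a'≢) , trans (Vecₚ.lookup∘tabulate rest _)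
        (cong e (trans (cong (Fin.punchIn b) (Finₚ.punchIn-punchOut a'≢)) (Finₚ.punchIn-punchOut b≢j))))

-- Ranking the supersets of a set

∣∁_∣ : ∀ {n} → Subset n → ℕ
∣∁ [] ∣ = 0
∣∁ true ∷ S ∣ = ∣∁ S ∣
∣∁ false ∷ S ∣ = suc ∣∁ S ∣

∣_╲_∣ : ∀ {n} → Subset n → Subset n → ℕ
∣ [] ╲ [] ∣ = 0
∣ _ ∷ T ╲ true ∷ S ∣ = ∣ T ╲ S ∣
∣ false ∷ T ╲ false ∷ S ∣ = ∣ T ╲ S ∣
∣ true ∷ T ╲ false ∷ S ∣ = suc ∣ T ╲ S ∣

∣∁∣+∣∣ : ∀ {n} (S : Subset n) → ∣∁ S ∣ + ∣ S ∣ ≡ n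
∣∁∣+∣∣ [] = refl
∣∁∣+∣∣ (true ∷ S) = trans (ℕₚ.+-suc _ _) (cong suc (∣∁∣+∣∣ S))
∣∁∣+∣∣ (false ∷ S) = cong suc (∣∁∣+∣∣ S)

∣╲∣+∣∣ : ∀ {n} (S T : Subset n) → S ⊆ T → ∣ T ╲ S ∣ + ∣ S ∣ ≡ ∣ T ∣
∣╲∣+∣∣ [] [] _ = refl
∣╲∣+∣∣ (true ∷ S) (true ∷ T) p = trans (ℕₚ.+-suc _ _) (cong suc (∣╲∣+∣∣ S T (Subₚ.drop-∷-⊆ p)))
∣╲∣+∣∣ (true ∷ S) (false ∷ T) p with p here
... | ()
∣╲∣+∣∣ (false ∷ S) (true ∷ T) p = cong suc (∣╲∣+∣∣ S T (Subₚ.drop-∷-⊆ p))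
∣╲∣+∣∣ (false ∷ S) (false ∷ T) p = ∣╲∣+∣∣ S T (Subₚ.drop-∷-⊆ p)

C-mono-suc : ∀ n k → n C k ≤ suc n C k
C-mono-suc n zero = ℕₚ.≤-refl
C-mono-suc n (suc k) = ℕₚ.≤-trans (ℕₚ.m≤n+m _ _) (ℕₚ.≤-reflexive (nCk+nC[k+1]≡[n+1]C[k+1] n k))

-- The rank of T among the supersets of S of the size of T.
rank : ∀ {n} → Subset n → Subset n → ℕ
rank [] [] = 0
rank (true ∷ S) (_ ∷ T) = rank S T
rank (false ∷ S) (false ∷ T) = rank S T
rank (false ∷ S) (true ∷ T) = ∣∁ S ∣ C suc ∣ T ╲ S ∣ + rank S T

-- Pascal's rule: sets that omit the first element outside `S` take the ranks below
-- `∣∁ S ∣ C suc ∣ T ╲ S ∣`, and those that contain it take the next `∣∁ S ∣ C ∣ T ╲ S ∣`.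
rank< : ∀ {n} (S T : Subset n) → rank S T < ∣∁ S ∣ C ∣ T ╲ S ∣
rank< [] [] = s≤s z≤n
rank< (true ∷ S) (_ ∷ T) = rank< S T
rank< (false ∷ S) (false ∷ T) = ℕₚ.≤-trans (rank< S T) (C-mono-suc ∣∁ S ∣ ∣ T ╲ S ∣)
rank< (false ∷ S) (true ∷ T) = ℕₚ.<-≤-trans (ℕₚ.+-monoʳ-< (∣∁ S ∣ C suc ∣ T ╲ S ∣) (rank< S T))
  (ℕₚ.≤-reflexive (trans (ℕₚ.+-comm (∣∁ S ∣ C suc ∣ T ╲ S ∣) _) (nCk+nC[k+1]≡[n+1]C[k+1] ∣∁ S ∣ ∣ T ╲ S ∣)))

-- If `T` and `U` differ at the first element outside `S`, then `rank<` bounds one rank strictly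
-- below the offset that the other contains.
rank-inj : ∀ {n} (S T U : Subset n) → S ⊆ T → S ⊆ U → ∣ T ╲ S ∣ ≡ ∣ U ╲ S ∣ → rank S T ≡ rank S U → T ≡ U
rank-inj [] [] [] _ _ _ _ = refl
rank-inj (true ∷ S) (a ∷ T) (b ∷ U) p q d r with p here | q here
... | here | here = cong (true ∷_) (rank-inj S T U (Subₚ.drop-∷-⊆ p) (Subₚ.drop-∷-⊆ q) d r)
rank-inj (false ∷ S) (false ∷ T) (false ∷ U) p q d r =
  cong (false ∷_) (rank-inj S T U (Subₚ.drop-∷-⊆ p) (Subₚ.drop-∷-⊆ q) d r)
rank-inj (false ∷ S) (true ∷ T) (true ∷ U) p q d r =
  cong (true ∷_) (rank-inj S T U (Subₚ.drop-∷-⊆ p) (Subₚ.drop-∷-⊆ q) d' (ℕₚ.+-cancelˡ-≡ (∣∁ S ∣ C suc ∣ T ╲ S ∣) _ _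
    (trans r (cong (λ k → ∣∁ S ∣ C suc k + rank S U) (sym d')))))
  where d' = ℕₚ.suc-injective d
rank-inj (false ∷ S) (true ∷ T) (false ∷ U) p q d r =
  ⊥-elim (ℕₚ.<⇒≱ (rank< S U) (subst₂ _≤_ (cong (∣∁ S ∣ C_) d) r (ℕₚ.m≤m+n _ (rank S T))))
rank-inj (false ∷ S) (false ∷ T) (true ∷ U) p q d r =
  ⊥-elim (ℕₚ.<⇒≱ (rank< S T) (subst₂ _≤_ (cong (∣∁ S ∣ C_) (sym d)) (sym r) (ℕₚ.m≤m+n _ (rank S U))))

unrank : ∀ {n} (S : Subset n) d v → v < ∣∁ S ∣ C d → ∃ λ T → S ⊆ T × ∣ T ╲ S ∣ ≡ d × rank S T ≡ v
unrank [] zero zero _ = [] , id , refl , refl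
unrank [] zero (suc v) (s≤s ())
unrank (true ∷ S) d v v< with unrank S d v v<
... | T , p , q , r = true ∷ T , Subₚ.in⊆in p , q , r
unrank (false ∷ S) zero v v< with unrank S zero v v<
... | T , p , q , r = false ∷ T , Subₚ.s⊆s p , q , r
unrank (false ∷ S) (suc d) v v< with v ℕₚ.<? ∣∁ S ∣ C suc d
... | yes v<' with unrank S (suc d) v v<'
... | T , p , q , r = false ∷ T , Subₚ.s⊆s p , q , r
unrank (false ∷ S) (suc d) v v< | no v≮ with unrank S d (v ∸ ∣∁ S ∣ C suc d)
  (ℕₚ.+-cancelˡ-< (∣∁ S ∣ C suc d) _ _ (subst₂ _<_ (sym (ℕₚ.m+[n∸m]≡n (ℕₚ.≮⇒≥ v≮)))
    (trans (sym (nCk+nC[k+1]≡[n+1]C[k+1] ∣∁ S ∣ d)) (ℕₚ.+-comm (∣∁ S ∣ C d) _)) v<))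
... | T , p , q , r = true ∷ T , Subₚ.out⊆ p , cong suc q ,
  trans (cong₂ (λ a b → ∣∁ S ∣ C suc a + b) q r) (ℕₚ.m+[n∸m]≡n (ℕₚ.≮⇒≥ v≮))

-- Interpolation modulo N

module Modular (N : ℕ) .{{_ : NonZero N}} where

  infix 4 _≈_
  -- Arithmetic stays in the integers, where ring identities can be solved, with an explicit
  -- quotient as witness; `rep` and `res` pass to the finite set `Fin N` for counting.
  record _≈_ (a b : ℤ) : Set where
    constructor congruent
    field
      quot : ℤ
      diff : a ≡ b +ᶻ quot *ᶻ + N

  ≈-reflexive : ∀ {a b} → a ≡ b → a ≈ b
  ≈-reflexive {a} refl = congruent 0ℤ (lemma a (+ N))
    where lemma : ∀ a n → a ≡ a +ᶻ 0ℤ *ᶻ n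
          lemma = solve-∀

  ≈-refl : ∀ {a} → a ≈ a
  ≈-refl = ≈-reflexive refl

  ≈-sym : ∀ {a b} → a ≈ b → b ≈ a
  ≈-sym {a} {b} (congruent k eq) = congruent (- k) (trans (lemma b k (+ N)) (cong (_+ᶻ (- k) *ᶻ + N) (sym eq)))
    where lemma : ∀ b k n → b ≡ b +ᶻ k *ᶻ n +ᶻ (- k) *ᶻ n
          lemma = solve-∀

  ≈-trans : ∀ {a b c} → a ≈ b → b ≈ c → a ≈ c
  ≈-trans {c = c} (congruent k refl) (congruent l refl) = congruent (l +ᶻ k) (lemma c k l (+ N))
    where lemma : ∀ c k l n → c +ᶻ l *ᶻ n +ᶻ k *ᶻ n ≡ c +ᶻ (l +ᶻ k) *ᶻ n
          lemma = solve-∀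

  +-cong : ∀ {a b c d} → a ≈ b → c ≈ d → a +ᶻ c ≈ b +ᶻ d
  +-cong {b = b} {d = d} (congruent k refl) (congruent l refl) = congruent (k +ᶻ l) (lemma b d k l (+ N))
    where lemma : ∀ b d k l n → (b +ᶻ k *ᶻ n) +ᶻ (d +ᶻ l *ᶻ n) ≡ b +ᶻ d +ᶻ (k +ᶻ l) *ᶻ n
          lemma = solve-∀

  *-cong : ∀ {a b c d} → a ≈ b → c ≈ d → a *ᶻ c ≈ b *ᶻ d
  *-cong {b = b} {d = d} (congruent k refl) (congruent l refl) =
    congruent (k *ᶻ d +ᶻ b *ᶻ l +ᶻ k *ᶻ l *ᶻ + N) (lemma b d k l (+ N))
    where lemma : ∀ b d k l n → (b +ᶻ k *ᶻ n) *ᶻ (d +ᶻ l *ᶻ n) ≡ b *ᶻ d +ᶻ (k *ᶻ d +ᶻ b *ᶻ l +ᶻ k *ᶻ l *ᶻ n) *ᶻ n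
          lemma = solve-∀

  +-congˡ : ∀ c {a b} → a ≈ b → c +ᶻ a ≈ c +ᶻ b
  +-congˡ c = +-cong (≈-refl {c})

  *-congˡ : ∀ c {a b} → a ≈ b → c *ᶻ a ≈ c *ᶻ b
  *-congˡ c = *-cong (≈-refl {c})

  *-congʳ : ∀ c {a b} → a ≈ b → a *ᶻ c ≈ b *ᶻ c
  *-congʳ c p = *-cong p (≈-refl {c})

  -‿cong : ∀ {a b} → a ≈ b → - a ≈ - b
  -‿cong {b = b} (congruent k refl) = congruent (- k) (lemma b k (+ N))
    where lemma : ∀ b k n → - (b +ᶻ k *ᶻ n) ≡ - b +ᶻ (- k) *ᶻ n
          lemma = solve-∀

  ≈-setoid : Setoid _ _
  ≈-setoid = record { Carrier = ℤ ; _≈_ = _≈_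
    ; isEquivalence = record { refl = ≈-refl ; sym = ≈-sym ; trans = ≈-trans } }

  +-cancelʳ : ∀ {a b c} → a +ᶻ c ≈ b +ᶻ c → a ≈ b
  +-cancelʳ {a} {b} {c} p = ≈-trans (≈-reflexive (lemma a c))
    (≈-trans (+-cong p (≈-refl { - c})) (≈-reflexive (sym (lemma b c))))
    where lemma : ∀ a c → a ≡ a +ᶻ c +ᶻ - c
          lemma = solve-∀

  rep : Fin N → ℤ
  rep x = + toℕ x

  res : ℤ → Fin N
  res a = Fin.fromℕ< (ℤᵈ.n%ℕd<d a N)

  rep-res : ∀ a → rep (res a) ≈ a
  rep-res a = ≈-sym (congruent (a Int./ℕ N)
    (trans (ℤᵈ.a≡a%ℕn+[a/ℕn]*n a N) (cong (λ k → + k +ᶻ (a Int./ℕ N) *ᶻ + N) (sym (Finₚ.toℕ-fromℕ< (ℤᵈ.n%ℕd<d a N))))))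

  private
    too-big : ∀ {a b k} → + a ≡ + b +ᶻ + suc k *ᶻ + N → ¬ a < N
    too-big {a} {b} {k} eq a<N = ℕₚ.<⇒≱ a<N (ℕₚ.≤-trans (ℕₚ.≤-trans (ℕₚ.m≤m+n N (k ℕ.* N)) (ℕₚ.m≤n+m _ b))
      (ℕₚ.≤-reflexive (sym (ℤₚ.+-injective (trans eq (cong (+ b +ᶻ_) (sym (ℤₚ.pos-* (suc k) N))))))))

  rep-inj : ∀ {x y} → rep x ≈ rep y → x ≡ y
  rep-inj {x} {y} (congruent (+ 0) eq) =
    Finₚ.toℕ-injective (ℤₚ.+-injective (trans eq (ℤₚ.+-identityʳ _)))
  rep-inj {x} {y} (congruent (+ suc k) eq) = ⊥-elim (too-big {k = k} eq (Finₚ.toℕ<n x))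
  rep-inj {x} {y} p@(congruent (-[1+ k ]) eq) = ⊥-elim (too-big {k = k} (_≈_.diff (≈-sym p)) (Finₚ.toℕ<n y))

  res-cong : ∀ {a b} → a ≈ b → res a ≡ res b
  res-cong p = rep-inj (≈-trans (rep-res _) (≈-trans p (≈-sym (rep-res _))))

  res-rep : ∀ x → res (rep x) ≡ x
  res-rep x = rep-inj (rep-res _)

-- A case split on zero kept as a function, so that sums and scalar factors can be moved through it.
pick : {A : Set} → ℕ → A → A → A
pick zero a _ = a
pick (suc _) _ b = b

module DividedDifference (inv : ℤ → ℤ) where

  -- Slopes towards the first node. For a polynomial of positive degree they form a polynomial of
  -- degree one less with the same leading coefficient.
  reduce : ∀ {n} (α v : Fin (suc n) → ℤ) → Fin n → ℤ
  reduce α v i = (v (suc i) - v zero) *ᶻ inv (α (suc i) - α zero)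

  -- The divided difference of v on the nodes α i with i ∈ S, if inv inverts the differences of nodes.
  D : ∀ {n} → Subset n → (α v : Fin n → ℤ) → ℤ
  D [] α v = 0ℤ
  D (false ∷ S) α v = D S (α ∘ suc) (v ∘ suc)
  D (true ∷ S) α v = pick ∣ S ∣ (v zero) (D S (α ∘ suc) (reduce α v))

  D-cong : ∀ {n} (S : Subset n) α {v w : Fin n → ℤ} → (∀ i → v i ≡ w i) → D S α v ≡ D S α w
  D-cong [] α eq = refl
  D-cong (false ∷ S) α eq = D-cong S (α ∘ suc) (eq ∘ suc)
  D-cong (true ∷ S) α eq = cong₂ (pick ∣ S ∣) (eq zero)
    (D-cong S (α ∘ suc) λ i → cong (_*ᶻ inv (α (suc i) - α zero)) (cong₂ _-_ (eq (suc i)) (eq zero)))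

  -- Linearity in `v` holds exactly and for arbitrary `inv`, as `inv` is applied to differences of
  -- nodes only.
  D-+ : ∀ {n} (S : Subset n) α (v w : Fin n → ℤ) → D S α (λ i → v i +ᶻ w i) ≡ D S α v +ᶻ D S α w
  D-+ [] α v w = refl
  D-+ (false ∷ S) α v w = D-+ S (α ∘ suc) (v ∘ suc) (w ∘ suc)
  D-+ (true ∷ S) α v w = trans
    (cong (pick ∣ S ∣ (v zero +ᶻ w zero)) (trans
      (D-cong S (α ∘ suc) λ i → lemma (v (suc i)) (w (suc i)) (v zero) (w zero) (inv (α (suc i) - α zero)))
      (D-+ S (α ∘ suc) (reduce α v) (reduce α w))))
    (pick-+ ∣ S ∣)
    where
    lemma : ∀ a b c d e → ((a +ᶻ b) - (c +ᶻ d)) *ᶻ e ≡ (a - c) *ᶻ e +ᶻ (b - d) *ᶻ e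
    lemma = solve-∀
    pick-+ : ∀ k {a b c d} → pick k (a +ᶻ b) (c +ᶻ d) ≡ pick k a c +ᶻ pick k b d
    pick-+ zero = refl
    pick-+ (suc k) = refl

  D-* : ∀ {n} (S : Subset n) α c (v : Fin n → ℤ) → D S α (λ i → c *ᶻ v i) ≡ c *ᶻ D S α v
  D-* [] α c v = sym (ℤₚ.*-zeroʳ c)
  D-* (false ∷ S) α c v = D-* S (α ∘ suc) c (v ∘ suc)
  D-* (true ∷ S) α c v = trans
    (cong (pick ∣ S ∣ (c *ᶻ v zero)) (trans
      (D-cong S (α ∘ suc) λ i → lemma c (v (suc i)) (v zero) (inv (α (suc i) - α zero)))
      (D-* S (α ∘ suc) c (reduce α v))))
    (pick-* ∣ S ∣)
    where
    lemma : ∀ c a b e → (c *ᶻ a - c *ᶻ b) *ᶻ e ≡ c *ᶻ ((a - b) *ᶻ e)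
    lemma = solve-∀
    pick-* : ∀ k {a b} → pick k (c *ᶻ a) (c *ᶻ b) ≡ c *ᶻ pick k a b
    pick-* zero = refl
    pick-* (suc k) = refl

  D-0 : ∀ {n} (S : Subset n) α → D S α (λ _ → 0ℤ) ≡ 0ℤ
  D-0 S α = D-* S α 0ℤ (λ _ → 0ℤ)

  D-singleton : ∀ {n} (S : Subset n) α v → ∣ S ∣ ≡ 0 → D (true ∷ S) α v ≡ v zero
  D-singleton S α v eq rewrite eq = refl

  D-step : ∀ {n} (S : Subset n) α v {k} → ∣ S ∣ ≡ suc k → D (true ∷ S) α v ≡ D S (α ∘ suc) (reduce α v)
  D-step S α v eq rewrite eq = refl

-- The leading coefficient is a separate argument because it is the divided difference, the quantity
-- that the blocks constrain.
horner : ∀ {s} → Vec ℤ s → ℤ → ℤ → ℤ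
horner [] top x = top
horner (c ∷ cs) top x = c +ᶻ x *ᶻ horner cs top x

-- A step of Newton's form: the coefficients of c + (x - a) q(x), except the leading one, which is
-- again `top`.
mulLinear : ∀ {s} → ℤ → ℤ → Vec ℤ s → ℤ → Vec ℤ (suc s)
mulLinear a c [] top = (c - a *ᶻ top) ∷ []
mulLinear a c (q ∷ qs) top = (c - a *ᶻ q) ∷ mulLinear a q qs top

horner-mulLinear : ∀ {s} a c (q : Vec ℤ s) top x →
  horner (mulLinear a c q top) top x ≡ c +ᶻ (x - a) *ᶻ horner q top x
horner-mulLinear a c [] top x = lemma a c top x
  where
  lemma : ∀ a c t x → (c - a *ᶻ t) +ᶻ x *ᶻ t ≡ c +ᶻ (x - a) *ᶻ t
  lemma = solve-∀
horner-mulLinear a c (q ∷ qs) top x =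
  trans (cong (λ h → (c - a *ᶻ q) +ᶻ x *ᶻ h) (horner-mulLinear a q qs top x)) (lemma a c q x (horner qs top x))
  where
  lemma : ∀ a c q x h → (c - a *ᶻ q) +ᶻ x *ᶻ (q +ᶻ (x - a) *ᶻ h) ≡ c +ᶻ (x - a) *ᶻ (q +ᶻ x *ᶻ h)
  lemma = solve-∀

module Interpolation (N : ℕ) .{{_ : NonZero N}} (inv : ℤ → ℤ) where
  open Modular N
  open DividedDifference inv

  Regular : ∀ {n} → (Fin n → ℤ) → Set
  Regular α = ∀ {i j} → i Fin.< j → (α j - α i) *ᶻ inv (α j - α i) ≈ 1ℤ

  -- Newton interpolation: if q interpolates the slopes on the later nodes, then v 0 + (x - α 0)
  -- q(x) interpolates `v`. The leading coefficient never changes, so it is `D S α v`.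
  interpolate : ∀ {n} (S : Subset n) {s} → ∣ S ∣ ≡ suc s → ∀ α v → Regular α →
    ∃ λ (cs : Vec ℤ s) → ∀ {i} → i ∈ S → horner cs (D S α v) (α i) ≈ v i
  interpolate (false ∷ S) eq α v reg with interpolate S eq (α ∘ suc) (v ∘ suc) (reg ∘ s≤s)
  ... | cs , ok = cs , λ { (there p) → ok p }
  interpolate (true ∷ S) {zero} eq α v reg = [] , λ
    { here → ≈-reflexive (D-singleton S α v (ℕₚ.suc-injective eq))
    ; (there p) → ⊥-elim (empty S (ℕₚ.suc-injective eq) p) }
    where
    empty : ∀ {n} (S : Subset n) → ∣ S ∣ ≡ 0 → ∀ {i} → i ∉ S
    empty (false ∷ S) eq (there p) = empty S eq p
  interpolate (true ∷ S) {suc s} eq α v reg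
    with interpolate S (ℕₚ.suc-injective eq) (α ∘ suc) (reduce α v) (reg ∘ s≤s)
  ... | q , ok rewrite D-step S α v (ℕₚ.suc-injective eq) =
    mulLinear (α zero) (v zero) q top , λ
    { here → ≈-reflexive (trans (horner-mulLinear (α zero) (v zero) q top (α zero)) (lemma (v zero) (α zero) _))
    ; {suc i} (there p) → begin
        horner (mulLinear (α zero) (v zero) q top) top (α (suc i))   ≡⟨ horner-mulLinear (α zero) (v zero) q top (α (suc i)) ⟩
        v zero +ᶻ (α (suc i) - α zero) *ᶻ horner q top (α (suc i))   ≈⟨ +-congˡ (v zero) (*-congˡ (α (suc i) - α zero) (ok p)) ⟩
        v zero +ᶻ (α (suc i) - α zero) *ᶻ reduce α v i               ≡⟨ lemma' (v zero) (v (suc i)) (α (suc i) - α zero) _ ⟩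
        v zero +ᶻ (α (suc i) - α zero) *ᶻ inv (α (suc i) - α zero) *ᶻ (v (suc i) - v zero)
                                                                     ≈⟨ +-congˡ (v zero) (*-congʳ (v (suc i) - v zero) (reg (s≤s z≤n))) ⟩
        v zero +ᶻ 1ℤ *ᶻ (v (suc i) - v zero)                         ≡⟨ lemma″ (v zero) (v (suc i)) ⟩
        v (suc i)                                                    ∎ }
    where
    open SetoidReasoning ≈-setoid
    top = D S (α ∘ suc) (reduce α v)
    lemma : ∀ c a h → c +ᶻ (a - a) *ᶻ h ≡ c
    lemma = solve-∀
    lemma' : ∀ a b d e → a +ᶻ d *ᶻ ((b - a) *ᶻ e) ≡ a +ᶻ d *ᶻ e *ᶻ (b - a)
    lemma' = solve-∀
    lemma″ : ∀ a b → a +ᶻ 1ℤ *ᶻ (b - a) ≡ b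
    lemma″ = solve-∀

-- Words with prescribed divided differences

∑ : ∀ {n} → (Subset n → ℤ) → ℤ
∑ {zero} f = f []
∑ {suc n} f = ∑ (λ U → f (false ∷ U)) +ᶻ ∑ (λ U → f (true ∷ U))

∑-cong : ∀ {n} {f g : Subset n → ℤ} → (∀ U → f U ≡ g U) → ∑ f ≡ ∑ g
∑-cong {zero} eq = eq []
∑-cong {suc n} eq = cong₂ _+ᶻ_ (∑-cong (eq ∘ (false ∷_))) (∑-cong (eq ∘ (true ∷_)))

∑-+ : ∀ {n} (f g : Subset n → ℤ) → ∑ (λ U → f U +ᶻ g U) ≡ ∑ f +ᶻ ∑ g
∑-+ {zero} f g = refl
∑-+ {suc n} f g = trans
  (cong₂ _+ᶻ_ (∑-+ (f ∘ (false ∷_)) (g ∘ (false ∷_))) (∑-+ (f ∘ (true ∷_)) (g ∘ (true ∷_))))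
  (lemma (∑ (f ∘ (false ∷_))) (∑ (g ∘ (false ∷_))) (∑ (f ∘ (true ∷_))) (∑ (g ∘ (true ∷_))))
  where
  lemma : ∀ a b c d → (a +ᶻ b) +ᶻ (c +ᶻ d) ≡ (a +ᶻ c) +ᶻ (b +ᶻ d)
  lemma = solve-∀

∑-* : ∀ {n} c (f : Subset n → ℤ) → ∑ (λ U → c *ᶻ f U) ≡ c *ᶻ ∑ f
∑-* {zero} c f = refl
∑-* {suc n} c f = trans (cong₂ _+ᶻ_ (∑-* c (f ∘ (false ∷_))) (∑-* c (f ∘ (true ∷_))))
  (sym (ℤₚ.*-distribˡ-+ c (∑ (f ∘ (false ∷_))) _))

∑-swap : ∀ {m n} (f : Subset m → Subset n → ℤ) → ∑ (λ U → ∑ (f U)) ≡ ∑ (λ V → ∑ (λ U → f U V))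
∑-swap {zero} f = refl
∑-swap {suc m} f = trans (cong₂ _+ᶻ_ (∑-swap (f ∘ (false ∷_))) (∑-swap (f ∘ (true ∷_))))
  (sym (∑-+ (λ V → ∑ (λ U → f (false ∷ U) V)) (λ V → ∑ (λ U → f (true ∷ U) V))))

∑-0 : ∀ n → ∑ {n} (λ _ → 0ℤ) ≡ 0ℤ
∑-0 n = ∑-* {n} 0ℤ (λ _ → 0ℤ)

bit : Bool → ℤ
bit false = 0ℤ
bit true = 1ℤ

nodes : ∀ {n} → (Fin n → ℤ) → Subset n → Fin n → ℤ
nodes base ε i = base i +ᶻ bit (lookup ε i)

origin : ∀ {n} → Subset n → ℤ
origin [] = 1ℤ
origin (false ∷ ε) = origin ε
origin (true ∷ ε) = 0ℤ

∑-origin : ∀ n → ∑ (origin {n}) ≡ 1ℤ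
∑-origin zero = refl
∑-origin (suc n) = cong₂ _+ᶻ_ (∑-origin n) (∑-0 n)

lastNode : ∀ {n} → Subset n → (Fin n → ℤ) → ℤ
lastNode [] base = 0ℤ
lastNode (false ∷ S) base = lastNode S (base ∘ suc)
lastNode (true ∷ S) base = pick ∣ S ∣ (base zero +ᶻ bit false) (lastNode S (base ∘ suc))

lastNode-node : ∀ {n} (S : Subset n) base {s} → ∣ S ∣ ≡ suc s → ∃ λ i → lastNode S base ≡ base i +ᶻ bit false
lastNode-node (false ∷ S) base eq = let i , p = lastNode-node S (base ∘ suc) eq in suc i , p
lastNode-node (true ∷ S) base eq with ∣ S ∣ in eq'
... | zero = zero , refl
... | suc _ = let i , p = lastNode-node S (base ∘ suc) eq' in suc i , p

gap : ℤ → ℤ → Bool → ℤ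
gap l x b = l - (x +ᶻ bit b)

-- With gaps f and g = f - 1, the weights -fg and fg add up to 0, but divided by their gaps they add
-- up to -g + f = 1.
weight : Bool → ℤ → ℤ → ℤ
weight false l x = - (gap l x false *ᶻ gap l x true)
weight true l x = gap l x false *ᶻ gap l x true

-- A word supported on the last element of S and, as a function of ε, on the subcube of the other
-- elements of S, where it alternates in sign. Summing its divided differences on U over ε leaves the
-- mixed difference, over the nodes in S, of the product of 1 / (last - node): it vanishes unless U
-- contains S, because otherwise the summands cancel in pairs, and the weights make it 1 for U = S.
isolator : ∀ {n} → Subset n → (Fin n → ℤ) → Subset n → Fin n → ℤ
isolator (false ∷ S) base (b ∷ ε) zero = 0ℤ
isolator (false ∷ S) base (true ∷ ε) (suc i) = 0ℤ
isolator (false ∷ S) base (false ∷ ε) (suc i) = isolator S (base ∘ suc) ε i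
isolator (true ∷ S) base (b ∷ ε) zero = pick ∣ S ∣ (origin (b ∷ ε)) 0ℤ
isolator (true ∷ S) base (b ∷ ε) (suc i) =
  pick ∣ S ∣ 0ℤ (weight b (lastNode S (base ∘ suc)) (base zero) *ᶻ isolator S (base ∘ suc) ε i)

origin-support : ∀ {n} b (ε : Subset n) (f : ℤ → ℤ) x → origin (b ∷ ε) *ᶻ f (x +ᶻ bit b) ≡ origin (b ∷ ε) *ᶻ f (x +ᶻ bit false)
origin-support false ε f x = refl
origin-support true ε f x = refl

pick-support : ∀ k (f : ℤ → ℤ) {p q y r s} → p *ᶻ f y ≡ p *ᶻ f r → q *ᶻ f y ≡ q *ᶻ f s →
  pick k p q *ᶻ f y ≡ pick k p q *ᶻ f (pick k r s)
pick-support zero f u v = u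
pick-support (suc k) f u v = v

-- Where the isolator is nonzero, `i` is the last element of `S` and `ε` vanishes there. So a factor
-- that depends on the node of `i` is effectively a constant.
isolator-support : ∀ {n} (S : Subset n) base ε (f : ℤ → ℤ) i →
  isolator S base ε i *ᶻ f (nodes base ε i) ≡ isolator S base ε i *ᶻ f (lastNode S base)
isolator-support (false ∷ S) base (b ∷ ε) f zero = refl
isolator-support (false ∷ S) base (true ∷ ε) f (suc i) = refl
isolator-support (false ∷ S) base (false ∷ ε) f (suc i) = isolator-support S (base ∘ suc) ε f i
isolator-support (true ∷ S) base (b ∷ ε) f zero =
  pick-support ∣ S ∣ f (origin-support b ε f (base zero)) refl
isolator-support (true ∷ S) base (b ∷ ε) f (suc i) =
  pick-support ∣ S ∣ f refl (trans (ℤₚ.*-assoc w _ _)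
    (trans (cong (w *ᶻ_) (isolator-support S (base ∘ suc) ε f i)) (sym (ℤₚ.*-assoc w (isolator S (base ∘ suc) ε i) _))))
  where w = weight b (lastNode S (base ∘ suc)) (base zero)

∣∣≡0⇒⊆ : ∀ {n} (S U : Subset n) → ∣ S ∣ ≡ 0 → S ⊆ U
∣∣≡0⇒⊆ (false ∷ S) (_ ∷ U) eq (there p) = there (∣∣≡0⇒⊆ S U eq p)

⊆∧∣∣≡⇒≡ : ∀ {n} {S U : Subset n} → U ⊆ S → ∣ U ∣ ≡ ∣ S ∣ → U ≡ S
⊆∧∣∣≡⇒≡ {S = []} {[]} p eq = refl
⊆∧∣∣≡⇒≡ {S = false ∷ S} {false ∷ U} p eq = cong (false ∷_) (⊆∧∣∣≡⇒≡ (Subₚ.drop-∷-⊆ p) eq)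
⊆∧∣∣≡⇒≡ {S = true ∷ S} {true ∷ U} p eq = cong (true ∷_) (⊆∧∣∣≡⇒≡ (Subₚ.drop-∷-⊆ p) (ℕₚ.suc-injective eq))
⊆∧∣∣≡⇒≡ {S = true ∷ S} {false ∷ U} p eq =
  ⊥-elim (ℕₚ.<⇒≢ (s≤s (Subₚ.p⊆q⇒∣p∣≤∣q∣ (Subₚ.drop-∷-⊆ p))) eq)
⊆∧∣∣≡⇒≡ {S = false ∷ S} {true ∷ U} p eq with p here
... | ()

module Isolation (N : ℕ) .{{_ : NonZero N}} (inv : ℤ → ℤ) where
  open Modular N
  open DividedDifference inv

  ∑-≈ : ∀ {n} {f g : Subset n → ℤ} → (∀ U → f U ≈ g U) → ∑ f ≈ ∑ g
  ∑-≈ {zero} eq = eq []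
  ∑-≈ {suc n} eq = +-cong (∑-≈ (eq ∘ (false ∷_))) (∑-≈ (eq ∘ (true ∷_)))

  ∑-≈0 : ∀ {n} {f : Subset n → ℤ} → (∀ U → f U ≈ 0ℤ) → ∑ f ≈ 0ℤ
  ∑-≈0 {n} eq = ≈-trans (∑-≈ eq) (≈-reflexive (∑-0 n))

  ∑-single : ∀ {n} (f : Subset n → ℤ) S → (∀ U → U ≢ S → f U ≈ 0ℤ) → ∑ f ≈ f S
  ∑-single f [] _ = ≈-refl
  ∑-single f (false ∷ S) h = ≈-trans
    (+-cong (∑-single (f ∘ (false ∷_)) S λ U ne → h _ λ { refl → ne refl })
            (∑-≈0 {f = f ∘ (true ∷_)} λ U → h _ λ ()))
    (≈-reflexive (ℤₚ.+-identityʳ _))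
  ∑-single f (true ∷ S) h = ≈-trans
    (+-cong (∑-≈0 {f = f ∘ (false ∷_)} λ U → h _ λ ())
            (∑-single (f ∘ (true ∷_)) S λ U ne → h _ λ { refl → ne refl }))
    (≈-reflexive (ℤₚ.+-identityˡ _))

  CubeRegular : ∀ {n} → (Fin n → ℤ) → Set
  CubeRegular base = ∀ {i j} → i Fin.< j → ∀ a b →
    let d = (base j +ᶻ bit b) - (base i +ᶻ bit a) in d *ᶻ inv d ≈ 1ℤ

  κ : ∀ {n} → Subset n → Subset n → (Fin n → ℤ) → ℤ
  κ S U base = ∑ λ ε → D U (nodes base ε) (isolator S base ε)

  private
    pick-0* : ∀ k c {x} → pick k 0ℤ (c *ᶻ x) ≡ pick k 0ℤ c *ᶻ x
    pick-0* zero c = refl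
    pick-0* (suc k) c = refl

  module _ {n} (S U : Subset n) (base : Fin (suc n) → ℤ) where
    private
      l = lastNode S (base ∘ suc)
      x = base zero
      K : Bool → ℤ
      K b = pick ∣ U ∣ 0ℤ (inv (gap l x b))
      d : Subset n → ℤ
      d ε = D U (nodes (base ∘ suc) ε) (isolator S (base ∘ suc) ε)

    -- As `v` vanishes at the first node, its slopes are quotients of `v`, and by `isolator-support`
    -- the divisor is always `gap l x b`, a scalar. For empty `U` the divided difference is
    -- `v zero`, hence the 0 in `K`.
    D-reduce : ∀ b ε (v : Fin (suc n) → ℤ) c → v zero ≡ 0ℤ → (∀ i → v (suc i) ≡ c *ᶻ isolator S (base ∘ suc) ε i) →
      D (true ∷ U) (nodes base (b ∷ ε)) v ≡ (c *ᶻ K b) *ᶻ d ε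
    D-reduce b ε v c v0 vs = trans (cong₂ (pick ∣ U ∣) v0 (trans (D-cong U _ reduce≡) (D-* U _ (c *ᶻ inv (gap l x b)) _)))
      (trans (pick-0* ∣ U ∣ (c *ᶻ inv (gap l x b)))
        (cong (_*ᶻ d ε) (pick-c ∣ U ∣)))
      where
      pick-c : ∀ k {y} → pick k 0ℤ (c *ᶻ y) ≡ c *ᶻ pick k 0ℤ y
      pick-c zero = sym (ℤₚ.*-zeroʳ c)
      pick-c (suc k) = refl
      lemma : ∀ c g w → (c *ᶻ g - 0ℤ) *ᶻ w ≡ c *ᶻ (g *ᶻ w)
      lemma = solve-∀
      lemma' : ∀ c g w → c *ᶻ (g *ᶻ w) ≡ c *ᶻ w *ᶻ g
      lemma' = solve-∀
      reduce≡ : ∀ i → reduce (nodes base (b ∷ ε)) v i ≡ c *ᶻ inv (gap l x b) *ᶻ isolator S (base ∘ suc) ε i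
      reduce≡ i = trans (cong₂ (λ p q → (p - q) *ᶻ inv (nodes base (b ∷ ε) (suc i) - nodes base (b ∷ ε) zero)) (vs i) v0)
        (trans (lemma c (isolator S (base ∘ suc) ε i) _)
        (trans (cong (c *ᶻ_) (isolator-support S (base ∘ suc) ε (λ y → inv (y - (x +ᶻ bit b))) i))
          (lemma' c (isolator S (base ∘ suc) ε i) _)))

    private
      D-outside : ∀ ε → D U (nodes (base ∘ suc) ε) (isolator (false ∷ S) base (true ∷ ε) ∘ suc) ≡ 0ℤ
      D-outside ε = D-0 U (nodes (base ∘ suc) ε)

    κ-out-out : κ (false ∷ S) (false ∷ U) base ≡ κ S U (base ∘ suc)
    κ-out-out = trans (cong (κ S U (base ∘ suc) +ᶻ_) (trans (∑-cong D-outside) (∑-0 n))) (ℤₚ.+-identityʳ _)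

    κ-out-in : κ (false ∷ S) (true ∷ U) base ≡ K false *ᶻ κ S U (base ∘ suc)
    κ-out-in = trans (cong₂ _+ᶻ_
      (trans (∑-cong λ ε → trans (D-reduce false ε (isolator (false ∷ S) base (false ∷ ε)) 1ℤ refl (λ i → sym (ℤₚ.*-identityˡ _)))
          (cong (_*ᶻ d ε) (ℤₚ.*-identityˡ (K false)))) (∑-* (K false) d))
      (trans (∑-cong λ ε → D-reduce true ε (isolator (false ∷ S) base (true ∷ ε)) 0ℤ refl (λ i → refl)) (∑-0 n)))
      (ℤₚ.+-identityʳ _)

    module _ {s} (∣S∣ : ∣ S ∣ ≡ suc s) where
      private
        tail≡ : ∀ b ε i → isolator (true ∷ S) base (b ∷ ε) (suc i) ≡ weight b l x *ᶻ isolator S (base ∘ suc) ε i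
        tail≡ b ε i rewrite ∣S∣ = refl
        head≡ : ∀ b ε → isolator (true ∷ S) base (b ∷ ε) zero ≡ 0ℤ
        head≡ b ε rewrite ∣S∣ = refl

      -- `U` does not see the first node, so its bit enters through the weight alone, and the two
      -- weights cancel.
      κ-in-out : κ (true ∷ S) (false ∷ U) base ≡ 0ℤ
      κ-in-out = trans (cong₂ _+ᶻ_ (half false) (half true)) (lemma (weight true l x) (κ S U (base ∘ suc)))
        where
        half : ∀ b → ∑ (λ ε → D (false ∷ U) (nodes base (b ∷ ε)) (isolator (true ∷ S) base (b ∷ ε))) ≡
          weight b l x *ᶻ κ S U (base ∘ suc)
        half b = trans (∑-cong λ ε → trans (D-cong U _ (tail≡ b ε)) (D-* U _ (weight b l x) _)) (∑-* (weight b l x) d)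
        lemma : ∀ w k → (- w) *ᶻ k +ᶻ w *ᶻ k ≡ 0ℤ
        lemma = solve-∀

      κ-in-in : κ (true ∷ S) (true ∷ U) base ≡
        (weight false l x *ᶻ K false +ᶻ weight true l x *ᶻ K true) *ᶻ κ S U (base ∘ suc)
      κ-in-in = trans (cong₂ _+ᶻ_ (half false) (half true))
        (sym (ℤₚ.*-distribʳ-+ (κ S U (base ∘ suc)) (weight false l x *ᶻ K false) _))
        where
        half : ∀ b → ∑ (λ ε → D (true ∷ U) (nodes base (b ∷ ε)) (isolator (true ∷ S) base (b ∷ ε))) ≡
          (weight b l x *ᶻ K b) *ᶻ κ S U (base ∘ suc)
        half b = trans (∑-cong λ ε → D-reduce b ε (isolator (true ∷ S) base (b ∷ ε)) (weight b l x) (head≡ b ε) (tail≡ b ε)) (∑-* (weight b l x *ᶻ K b) d)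

  private
    *≈0 : ∀ c {a} → a ≈ 0ℤ → c *ᶻ a ≈ 0ℤ
    *≈0 c p = ≈-trans (*-congˡ c p) (≈-reflexive (ℤₚ.*-zeroʳ c))

  -- At a group in `S` but not in `U`, the two values of the bit cancel, or, if the group is the
  -- last of `S`, the isolator vanishes on the rest. Every other group only contributes a factor.
  κ-⊈ : ∀ {n} (S U : Subset n) base → ¬ S ⊆ U → κ S U base ≈ 0ℤ
  κ-⊈ [] [] base ⊈ = ⊥-elim (⊈ id)
  κ-⊈ (false ∷ S) (false ∷ U) base ⊈ = ≈-trans (≈-reflexive (κ-out-out S U base)) (κ-⊈ S U (base ∘ suc) (⊈ ∘ Subₚ.out⊆))
  κ-⊈ (false ∷ S) (true ∷ U) base ⊈ = ≈-trans (≈-reflexive (κ-out-in S U base)) (*≈0 (pick ∣ U ∣ 0ℤ (inv (gap (lastNode S (base ∘ suc)) (base zero) false))) (κ-⊈ S U (base ∘ suc) (⊈ ∘ Subₚ.out⊆)))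
  κ-⊈ {suc n} (true ∷ S) U base ⊈ = go U ⊈ ∣ S ∣ refl
    where
    factor : Subset n → Bool → ℤ
    factor U b = weight b (lastNode S (base ∘ suc)) (base zero) *ᶻ
      pick ∣ U ∣ 0ℤ (inv (gap (lastNode S (base ∘ suc)) (base zero) b))
    go : ∀ U → ¬ true ∷ S ⊆ U → ∀ k → ∣ S ∣ ≡ k → κ (true ∷ S) U base ≈ 0ℤ
    go (true ∷ U) ⊈ zero eq = ⊥-elim (⊈ (Subₚ.in⊆in (∣∣≡0⇒⊆ S U eq)))
    go (false ∷ U) ⊈ zero eq = ≈-reflexive (trans (cong₂ _+ᶻ_ (half false) (half true)) refl)
      where
      tail≡ : ∀ b ε i → isolator (true ∷ S) base (b ∷ ε) (suc i) ≡ 0ℤ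
      tail≡ b ε i rewrite eq = refl
      half : ∀ b → ∑ (λ ε → D (false ∷ U) (nodes base (b ∷ ε)) (isolator (true ∷ S) base (b ∷ ε))) ≡ 0ℤ
      half b = trans (∑-cong λ ε → trans (D-cong U _ (tail≡ b ε)) (D-0 U _)) (∑-0 n)
    go (true ∷ U) ⊈ (suc k) eq = ≈-trans (≈-reflexive (κ-in-in S U base eq)) (*≈0 (factor U false +ᶻ factor U true) (κ-⊈ S U (base ∘ suc) (⊈ ∘ Subₚ.in⊆in)))
    go (false ∷ U) ⊈ (suc k) eq = ≈-reflexive (κ-in-out S U base eq)

  -- Each element of `S` before the last contributes the factor -g + f = 1 of `weight`; the last
  -- contributes the sum of `origin`, which is 1.
  κ-diagonal : ∀ {n} (S : Subset n) base {s} → ∣ S ∣ ≡ suc s → CubeRegular base → κ S S base ≈ 1ℤ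
  κ-diagonal (false ∷ S) base eq reg = ≈-trans (≈-reflexive (κ-out-out S S base)) (κ-diagonal S (base ∘ suc) eq (reg ∘ s≤s))
  κ-diagonal {suc n} (true ∷ S) base {zero} eq reg = ≈-reflexive (trans (∑-cong single) (∑-origin (suc n)))
    where
    single : ∀ ε → D (true ∷ S) (nodes base ε) (isolator (true ∷ S) base ε) ≡ origin ε
    single (b ∷ ε) rewrite ℕₚ.suc-injective eq = refl
  κ-diagonal {suc n} (true ∷ S) base {suc s} eq reg = begin
    κ (true ∷ S) (true ∷ S) base                                   ≡⟨ κ-in-in S S base ∣S∣ ⟩
    combination ∣ S ∣ *ᶻ κ S S (base ∘ suc)                        ≡⟨ cong (λ k → combination k *ᶻ κ S S (base ∘ suc)) ∣S∣ ⟩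
    (weight false l x *ᶻ inv f +ᶻ weight true l x *ᶻ inv g) *ᶻ κ S S (base ∘ suc)
      -- `combination` only tests whether its argument is zero, so 1 stands for `suc s`.
      ≈⟨ *-congˡ (combination 1) (κ-diagonal S (base ∘ suc) ∣S∣ (reg ∘ s≤s)) ⟩
    (weight false l x *ᶻ inv f +ᶻ weight true l x *ᶻ inv g) *ᶻ 1ℤ  ≡⟨ lemma f g (inv f) (inv g) ⟩
    - ((f *ᶻ inv f) *ᶻ g) +ᶻ f *ᶻ (g *ᶻ inv g)                     ≈⟨ +-cong (-‿cong (*-congʳ g (regular false))) (*-congˡ f (regular true)) ⟩
    - (1ℤ *ᶻ g) +ᶻ f *ᶻ 1ℤ                                         ≡⟨ lemma' l x ⟩
    1ℤ                                                             ∎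
    where
    open SetoidReasoning ≈-setoid
    ∣S∣ = ℕₚ.suc-injective eq
    l = lastNode S (base ∘ suc)
    x = base zero
    f = gap l x false
    g = gap l x true
    combination : ℕ → ℤ
    combination k = weight false l x *ᶻ pick k 0ℤ (inv f) +ᶻ weight true l x *ᶻ pick k 0ℤ (inv g)
    regular : ∀ b → gap l x b *ᶻ inv (gap l x b) ≈ 1ℤ
    regular b with lastNode-node S (base ∘ suc) ∣S∣
    ... | i , p rewrite p = reg {zero} {suc i} (s≤s z≤n) b false
    lemma : ∀ f g i j → ((- (f *ᶻ g)) *ᶻ i +ᶻ (f *ᶻ g) *ᶻ j) *ᶻ 1ℤ ≡ - ((f *ᶻ i) *ᶻ g) +ᶻ f *ᶻ (g *ᶻ j)
    lemma = solve-∀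
    lemma' : ∀ l x → - (1ℤ *ᶻ (l - (x +ᶻ 1ℤ))) +ᶻ (l - (x +ᶻ 0ℤ)) *ᶻ 1ℤ ≡ 1ℤ
    lemma' = solve-∀

  D-∑ : ∀ {n k} (S : Subset n) α (f : Subset k → Fin n → ℤ) → D S α (λ i → ∑ λ U → f U i) ≡ ∑ λ U → D S α (f U)
  D-∑ {k = zero} S α f = refl
  D-∑ {k = suc k} S α f = trans (D-+ S α _ _) (cong₂ _+ᶻ_ (D-∑ S α (f ∘ (false ∷_))) (D-∑ S α (f ∘ (true ∷_))))

  -- The `pick` is the indicator of the sets `U` with `m` elements.
  prescribe : ∀ {n} → ℕ → (Subset n → ℤ) → (Fin n → ℤ) → Subset n → Fin n → ℤ
  prescribe m c base ε i = ∑ λ U → pick ℕ.∣ ∣ U ∣ - m ∣ (c U) 0ℤ *ᶻ isolator U base ε i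

  -- Exchanging the sums leaves the terms `c U` times `κ U S base`. They vanish unless `U` is
  -- contained in `S`, and sets of equal size are then equal; `κ-diagonal` evaluates the surviving
  -- term.
  D-prescribe : ∀ {n} (S : Subset n) {m s} → m ≡ suc s → ∣ S ∣ ≡ m → ∀ c base → CubeRegular base →
    ∑ (λ ε → D S (nodes base ε) (prescribe m c base ε)) ≈ c S
  D-prescribe S {m} {s} m≡ ∣S∣≡m c base reg = begin
    ∑ (λ ε → D S (nodes base ε) (prescribe m c base ε))
      ≡⟨ ∑-cong (λ ε → trans (D-∑ S (nodes base ε) (λ U i → c' U *ᶻ isolator U base ε i)) (∑-cong λ U → D-* S (nodes base ε) (c' U) (isolator U base ε))) ⟩
    ∑ (λ ε → ∑ λ U → c' U *ᶻ D S (nodes base ε) (isolator U base ε))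
      ≡⟨ ∑-swap (λ ε U → c' U *ᶻ D S (nodes base ε) (isolator U base ε)) ⟩
    ∑ (λ U → ∑ λ ε → c' U *ᶻ D S (nodes base ε) (isolator U base ε))
      ≡⟨ ∑-cong (λ U → ∑-* (c' U) (λ ε → D S (nodes base ε) (isolator U base ε))) ⟩
    ∑ (λ U → c' U *ᶻ κ U S base)  ≈⟨ ∑-single _ S other ⟩
    c' S *ᶻ κ S S base            ≈⟨ *-congˡ (c' S) (κ-diagonal S base (trans ∣S∣≡m m≡) reg) ⟩
    c' S *ᶻ 1ℤ                    ≡⟨ ℤₚ.*-identityʳ (c' S) ⟩
    c' S                          ≡⟨ cong (λ k → pick k (c S) 0ℤ) (trans (cong ℕ.∣_- m ∣ ∣S∣≡m) (ℕₚ.∣n-n∣≡0 m)) ⟩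
    c S                           ∎
    where
    open SetoidReasoning ≈-setoid
    c' : Subset _ → ℤ
    c' U = pick ℕ.∣ ∣ U ∣ - m ∣ (c U) 0ℤ
    other : ∀ U → U ≢ S → c' U *ᶻ κ U S base ≈ 0ℤ
    other U U≢S with ℕ.∣ ∣ U ∣ - m ∣ in eq
    ... | suc _ = ≈-refl
    ... | zero = *≈0 (c U) (κ-⊈ U S base λ U⊆S →
      U≢S (⊆∧∣∣≡⇒≡ U⊆S (trans (ℕₚ.∣m-n∣≡0⇒m≡n eq) (sym ∣S∣≡m))))

-- The blocks of codewords

-- Functions on the cube as finite trees: extensionality and decidable equality are provable and
-- elements can be counted.
data Table (A : Set) : ℕ → Set where
  leaf : A → Table A zero
  fork : ∀ {n} → Table A n → Table A n → Table A (suc n)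

infixl 9 _‼_
_‼_ : ∀ {n} {A : Set} → Table A n → Subset n → A
leaf a ‼ [] = a
fork a b ‼ (false ∷ ε) = a ‼ ε
fork a b ‼ (true ∷ ε) = b ‼ ε

table : ∀ {n} {A : Set} → (Subset n → A) → Table A n
table {zero} f = leaf (f [])
table {suc n} f = fork (table (f ∘ (false ∷_))) (table (f ∘ (true ∷_)))

table-‼ : ∀ {n} {A : Set} (f : Subset n → A) ε → table f ‼ ε ≡ f ε
table-‼ f [] = refl
table-‼ f (false ∷ ε) = table-‼ (f ∘ (false ∷_)) ε
table-‼ f (true ∷ ε) = table-‼ (f ∘ (true ∷_)) ε

table-ext : ∀ {n} {A : Set} {a b : Table A n} → (∀ ε → a ‼ ε ≡ b ‼ ε) → a ≡ b
table-ext {a = leaf _} {leaf _} eq = cong leaf (eq [])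
table-ext {a = fork _ _} {fork _ _} eq = cong₂ fork (table-ext (eq ∘ (false ∷_))) (table-ext (eq ∘ (true ∷_)))

table-≟ : ∀ {n} {A : Set} → DecidableEquality A → DecidableEquality (Table A n)
table-≟ _≟_ (leaf a) (leaf b) with a ≟ b
... | yes refl = yes refl
... | no ≢ = no λ { refl → ≢ refl }
table-≟ _≟_ (fork a b) (fork c d) with table-≟ _≟_ a c | table-≟ _≟_ b d
... | yes refl | yes refl = yes refl
... | no ≢ | _ = no λ { refl → ≢ refl }
... | _ | no ≢ = no λ { refl → ≢ refl }

table↪ : ∀ n {A a} → A ↪ a → Table A n ↪ (a ^ (2 ^ n))
table↪ zero {a = a} (f , fi) = subst (Table _ zero ↪_) (sym (ℕₚ.*-identityʳ a))
  ((λ { (leaf x) → f x }) , λ { {leaf x} {leaf y} eq → cong leaf (fi eq) })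
table↪ (suc n) {a = a} e = let f , fi = table↪ n e ×↪ table↪ n e in subst (Table _ (suc n) ↪_)
  (trans (sym (ℕₚ.^-distribˡ-+-* a (2 ^ n) (2 ^ n))) (cong (λ k → a ^ (2 ^ n + k)) (sym (ℕₚ.+-identityʳ _))))
  ((λ { (fork x y) → f (x , y) }) ,
   λ { {fork x y} {fork x' y'} eq → let p , q = ,-injective (fi eq) in cong₂ fork p q })

module CodeBlocks {n : ℕ} (N : ℕ) .{{_ : NonZero N}} (inv : ℤ → ℤ) (base : Fin n → ℤ)
  (regular : Isolation.CubeRegular N inv base) (t m' lam K : ℕ) .{{_ : NonZero lam}}
  (m≤t : suc (suc m') ≤ t) (lam≡ : lam ≡ (n ∸ suc (suc m')) C (t ∸ suc (suc m'))) (N/lam<K : ∀ {w} → w < N → w / lam < K) where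

  open Modular N
  open DividedDifference inv
  open Interpolation N inv
  open Isolation N inv

  m : ℕ
  m = suc (suc m')

  Y : Set
  Y = Fin N × Table (Fin N) n

  Tops : Set
  Tops = Table (Vec (Fin N) m' × Fin N) n

  -- A block is a t-set of groups with, for every system of nodes, a polynomial of degree < m (constant
  -- term, middle coefficients, top coefficient). The sum of all top coefficients is lam * k modulo N,
  -- so one of them is not recorded.
  CodeBlock : Set
  CodeBlock = (∃ λ (T : Subset n) → ∣ T ∣ ≡ t) × Y × Vec (Fin N) m' × Tops × Fin K

  shift : Subset n → Subset n → Fin n → ℤ
  shift T = prescribe m (λ U → + rank U T) base

  tops : Tops → Subset n → ℤ
  tops r ε = rep (proj₂ (r ‼ ε))

  -- The additional letter. It carries no shift: by `D-prescribe` the letters indexed by the cube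
  -- already contribute the whole rank.
  word₀ : Fin N → Vec (Fin N) m' → Tops → Fin K → Fin n → ℤ
  word₀ c q r k i = horner (map rep (c ∷ q)) (+ (lam * toℕ k) - ∑ (tops r)) (nodes base ⊥ i)

  wordᵉ : Subset n → Fin N → Vec (Fin N) m' × Fin N → Subset n → Fin n → ℤ
  wordᵉ T c (q , top) ε i = horner (map rep (c ∷ q)) (rep top) (nodes base ε i) +ᶻ shift T ε i

  word : CodeBlock → Fin n → Y
  word ((T , _) , (c₀ , c) , q , r , k) i =
    res (word₀ c₀ q r k i) , table λ ε → res (wordᵉ T (c ‼ ε) (r ‼ ε) ε i)

  CodeMem : CodeBlock → Fin n × Y → Set
  CodeMem b@((T , _) , _) (i , y) = i ∈ T × y ≡ word b i

  -- The rank of `T` among the t-sets through the group of the point, and every recorded coefficient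
  -- except the constant terms, which the point determines.
  Code : Set
  Code = Fin ((n ∸ 1) C (t ∸ 1)) × Vec (Fin N) m' × Tops × Fin K

  private
    ⁅⁆⊆ : ∀ {i} {T : Subset n} → i ∈ T → ⁅ i ⁆ ⊆ T
    ⁅⁆⊆ {i} p q rewrite Subₚ.x∈⁅y⁆⇒x≡y i q = p

    ∣╲⁅⁆∣ : ∀ {i} (T : Subset n) → ∣ T ∣ ≡ t → i ∈ T → ∣ T ╲ ⁅ i ⁆ ∣ ≡ t ∸ 1
    ∣╲⁅⁆∣ {i} T refl p = trans (sym (ℕₚ.m+n∸n≡m _ 1))
      (cong (_∸ 1) (trans (cong (λ z → ∣ T ╲ ⁅ i ⁆ ∣ + z) (sym (Subₚ.∣⁅x⁆∣≡1 i))) (∣╲∣+∣∣ ⁅ i ⁆ T (⁅⁆⊆ p))))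

    rank⁅⁆< : ∀ {i} (T : Subset n) → ∣ T ∣ ≡ t → i ∈ T → rank ⁅ i ⁆ T < (n ∸ 1) C (t ∸ 1)
    rank⁅⁆< {i} T eq p = subst₂ (λ a b → rank ⁅ i ⁆ T < a C b)
      (trans (sym (ℕₚ.m+n∸n≡m _ 1)) (cong (_∸ 1) (trans (cong (λ z → ∣∁ ⁅ i ⁆ ∣ + z) (sym (Subₚ.∣⁅x⁆∣≡1 i))) (∣∁∣+∣∣ ⁅ i ⁆))))
      (∣╲⁅⁆∣ T eq p) (rank< ⁅ i ⁆ T)

    res-inj : ∀ {a b} → res a ≡ res b → a ≈ b
    res-inj {a} {b} eq = ≈-trans (≈-sym (rep-res a)) (≈-trans (≈-reflexive (cong rep eq)) (rep-res b))

    constant-term : ∀ c c' x → rep c +ᶻ x ≈ rep c' +ᶻ x → c ≡ c'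
    constant-term c c' x p = rep-inj (+-cancelʳ {c = x} p)

  code : ∀ b x → CodeMem b x → Code
  code ((T , ∣T∣) , _ , q , r , k) (i , y) (p , _) = Fin.fromℕ< (rank⁅⁆< T ∣T∣ p) , q , r , k

  -- Once `T`, the other coefficients and `k` agree, shifts and higher terms agree too, so equal
  -- letters force equal constant terms.
  code-inj : ∀ b b' x (p : CodeMem b x) (q : CodeMem b' x) → code b x p ≡ code b' x q → b ≡ b'
  code-inj b@((T , ∣T∣) , (c₀ , c) , q , r , k) b'@((T' , ∣T'∣) , (c₀' , c') , q' , r' , k') x@(i , y) (p , u) (p' , u') eq
    with ,-injective eq
  ... | rank≡ , eq' with rank-inj ⁅ i ⁆ T T' (⁅⁆⊆ p) (⁅⁆⊆ p') (trans (∣╲⁅⁆∣ T ∣T∣ p) (sym (∣╲⁅⁆∣ T' ∣T'∣ p')))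
    (Finₚ.fromℕ<-injective _ _ (rank⁅⁆< T ∣T∣ p) (rank⁅⁆< T' ∣T'∣ p') rank≡)
  ... | refl with ℕₚ.≡-irrelevant ∣T∣ ∣T'∣ | eq' | ,-injective (trans (sym u) u')
  ... | refl | refl | eq₀ , eqᵉ = cong (λ z → (T , ∣T∣) , z , q , r , k) (cong₂ _,_
    (constant-term c₀ c₀' (x₀ *ᶻ horner (map rep q) (+ (lam * toℕ k) - ∑ (tops r)) x₀) (res-inj eq₀))
    (table-ext λ ε → constant-term (c ‼ ε) (c' ‼ ε) (xᵉ ε *ᶻ horner (map rep (proj₁ (r ‼ ε))) (rep (proj₂ (r ‼ ε))) (xᵉ ε)) (+-cancelʳ {c = shift T ε i} (res-inj
      (trans (sym (table-‼ (λ ε → res (wordᵉ T (c ‼ ε) (r ‼ ε) ε i)) ε))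
        (trans (cong (_‼ ε) eqᵉ) (table-‼ (λ ε → res (wordᵉ T (c' ‼ ε) (r ‼ ε) ε i)) ε)))))))
    where
    x₀ = nodes base ⊥ i
    xᵉ : Subset n → ℤ
    xᵉ ε = nodes base ε i

  private
    position : ∀ b x → CodeMem b x → Fin t
    position ((T , ∣T∣) , _) _ (p , _) = let _ , _ , _ , sur = enumerate T in Fin.cast ∣T∣ (proj₁ (sur p))

    position-inj : ∀ b x x' (p : CodeMem b x) (q : CodeMem b x') → position b x p ≡ position b x' q → x ≡ x'
    position-inj b@((T , ∣T∣) , _) (i , y) (j , z) (p , u) (q , v) eq with enumerate T
    ... | e , _ , _ , sur with trans (sym (proj₂ (sur p))) (trans (cong e (Finₚ.toℕ-injective
      (trans (sym (Finₚ.toℕ-cast ∣T∣ (proj₁ (sur p)))) (trans (cong toℕ eq) (Finₚ.toℕ-cast ∣T∣ (proj₁ (sur q))))))) (proj₂ (sur q)))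
    ... | refl = cong (i ,_) (trans u (sym v))

  codeBlocks : Blocks (Fin n × Y) t Code
  codeBlocks = record
    { Block = CodeBlock ; Mem = CodeMem
    ; code = λ {b} {x} → code b x
    ; code-irr = λ _ _ → refl
    ; code-inj = λ {b} {b'} {x} → code-inj b b' x
    ; idx = λ {b} {x} → position b x
    ; idx-inj = λ {b} {x} {y} → position-inj b x y }

  module _ (e : Fin m → Fin n × Y) (transversal : Injective _≡_ _≡_ (proj₁ ∘ e)) where
    private
      S : Subset n
      S = image (proj₁ ∘ e)

      ∣S∣ : ∣ S ∣ ≡ m
      ∣S∣ = ∣image∣ (proj₁ ∘ e) transversal

      value : Fin n → Y
      value i with Finₚ.any? (λ j → proj₁ (e j) Fin.≟ i)
      ... | yes (j , _) = proj₂ (e j)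
      -- An arbitrary default; the prescribed values matter on `S` only.
      ... | no _ = proj₂ (e zero)

      value-e : ∀ j → value (proj₁ (e j)) ≡ proj₂ (e j)
      value-e j with Finₚ.any? (λ j' → proj₁ (e j') Fin.≟ proj₁ (e j))
      ... | yes (j' , eq) = cong (proj₂ ∘ e) (transversal eq)
      ... | no ¬p = ⊥-elim (¬p (j , refl))

      y₀ : Fin n → ℤ
      y₀ i = rep (proj₁ (value i))

      yᵉ : Subset n → Fin n → ℤ
      yᵉ ε i = rep (proj₂ (value i) ‼ ε)

      total : ℤ
      total = D S (nodes base ⊥) y₀ +ᶻ ∑ (λ ε → D S (nodes base ε) (yᵉ ε))

      -- The representative of `total` below `N`. Its remainder modulo `lam` selects `T`, and its
      -- quotient is `k`.
      w : ℕ
      w = toℕ (res total)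

      ∣∁S∣ : ∣∁ S ∣ ≡ n ∸ m
      ∣∁S∣ = trans (sym (ℕₚ.m+n∸n≡m ∣∁ S ∣ m)) (cong (_∸ m) (trans (cong (λ z → ∣∁ S ∣ + z) (sym ∣S∣)) (∣∁∣+∣∣ S)))

      completion : ∃ λ T → S ⊆ T × ∣ T ╲ S ∣ ≡ t ∸ m × rank S T ≡ w % lam
      completion = unrank S (t ∸ m) (w % lam) (ℕₚ.<-≤-trans (ℕᵈ.m%n<n w lam)
        (ℕₚ.≤-reflexive (trans lam≡ (cong (_C (t ∸ m)) (sym ∣∁S∣)))))

      T : Subset n
      T = proj₁ completion

      S⊆T : S ⊆ T
      S⊆T = proj₁ (proj₂ completion)

      ∣T∣ : ∣ T ∣ ≡ t
      ∣T∣ = trans (sym (∣╲∣+∣∣ S T S⊆T)) (trans (cong₂ _+_ (proj₁ (proj₂ (proj₂ completion))) ∣S∣) (ℕₚ.m∸n+n≡m m≤t))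

      k : Fin K
      k = Fin.fromℕ< (N/lam<K (Finₚ.toℕ<n (res total)))

      zᵉ : Subset n → Fin n → ℤ
      zᵉ ε i = yᵉ ε i - shift T ε i

      d₀ : ℤ
      d₀ = D S (nodes base ⊥) y₀

      dᵉ : Subset n → ℤ
      dᵉ ε = D S (nodes base ε) (zᵉ ε)

      nodes-regular : ∀ ε → Regular (nodes base ε)
      nodes-regular ε i<j = regular i<j _ _

      poly₀ : ∃ λ (cs : Vec ℤ (suc m')) → ∀ {i} → i ∈ S → horner cs d₀ (nodes base ⊥ i) ≈ y₀ i
      poly₀ = interpolate S ∣S∣ (nodes base ⊥) y₀ (nodes-regular ⊥)

      polyᵉ : ∀ ε → ∃ λ (cs : Vec ℤ (suc m')) → ∀ {i} → i ∈ S → horner cs (dᵉ ε) (nodes base ε i) ≈ zᵉ ε i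
      polyᵉ ε = interpolate S ∣S∣ (nodes base ε) (zᵉ ε) (nodes-regular ε)

      -- By `D-prescribe` the shifts account for `rank S T`, that is `w % lam`, of the total `w`.
      -- Subtracting them leaves `lam` times the quotient.
      sum-of-tops : d₀ +ᶻ ∑ dᵉ ≈ + (lam * toℕ k)
      sum-of-tops = +-cancelʳ {c = + rank S T} (begin
        d₀ +ᶻ ∑ dᵉ +ᶻ + rank S T   ≈⟨ +-congˡ (d₀ +ᶻ ∑ dᵉ) (D-prescribe S refl ∣S∣ (λ U → + rank U T) base regular) ⟨
        d₀ +ᶻ ∑ dᵉ +ᶻ ∑ sᵉ         ≡⟨ trans (ℤₚ.+-assoc d₀ (∑ dᵉ) (∑ sᵉ)) (cong (d₀ +ᶻ_) (trans (sym (∑-+ dᵉ sᵉ)) (∑-cong split))) ⟩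
        total                      ≈⟨ rep-res total ⟨
        + w                        ≡⟨ cong +_ (trans (ℕᵈ.m≡m%n+[m/n]*n w lam) (ℕₚ.+-comm (w % lam) _)) ⟩
        + (w / lam * lam + w % lam) ≡⟨ cong₂ (λ a b → + (a + b)) (trans (ℕₚ.*-comm (w / lam) lam)
                                        (cong (lam *_) (sym (Finₚ.toℕ-fromℕ< (N/lam<K (Finₚ.toℕ<n (res total)))))))
                                        (sym (proj₂ (proj₂ (proj₂ completion)))) ⟩
        + (lam * toℕ k + rank S T) ∎)
        where
        open SetoidReasoning ≈-setoid
        sᵉ : Subset n → ℤ
        sᵉ ε = D S (nodes base ε) (shift T ε)
        cancel : ∀ a b → (a - b) +ᶻ b ≡ a
        cancel = solve-∀
        split : ∀ ε → dᵉ ε +ᶻ sᵉ ε ≡ D S (nodes base ε) (yᵉ ε)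
        split ε = trans (sym (D-+ S (nodes base ε) (zᵉ ε) (shift T ε)))
          (D-cong S (nodes base ε) λ i → cancel (yᵉ ε i) (shift T ε i))

      cᵉ : Subset n → Vec ℤ (suc m')
      cᵉ ε = proj₁ (polyᵉ ε)

      c : Table (Fin N) n
      c = table λ ε → res (head (cᵉ ε))

      r : Tops
      r = table λ ε → map res (tail (cᵉ ε)) , res (dᵉ ε)

      block : CodeBlock
      block = (T , ∣T∣) , (res (head (proj₁ poly₀)) , c) , map res (tail (proj₁ poly₀)) , r , k

      horner-res : ∀ {s} (cs : Vec ℤ s) {a b} x → a ≈ b → horner (map rep (map res cs)) a x ≈ horner cs b x
      horner-res [] x p = p
      horner-res (c ∷ cs) x p = +-cong (rep-res c) (*-congˡ x (horner-res cs x p))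

      map-head-tail : ∀ {s} (cs : Vec ℤ (suc s)) → res (head cs) ∷ map res (tail cs) ≡ map res cs
      map-head-tail (c ∷ cs) = refl

      word₀≈ : ∀ {i} → i ∈ S → word₀ (res (head (proj₁ poly₀))) (map res (tail (proj₁ poly₀))) r k i ≈ y₀ i
      word₀≈ {i} p = begin
        horner (map rep (res (head c₀) ∷ map res (tail c₀))) top (nodes base ⊥ i)
          ≡⟨ cong (λ cs → horner (map rep cs) top (nodes base ⊥ i)) (map-head-tail c₀) ⟩
        horner (map rep (map res c₀)) top (nodes base ⊥ i)
          ≈⟨ horner-res c₀ (nodes base ⊥ i) top≈ ⟩
        horner c₀ d₀ (nodes base ⊥ i)  ≈⟨ proj₂ poly₀ p ⟩
        y₀ i                           ∎
        where
        open SetoidReasoning ≈-setoid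
        c₀ = proj₁ poly₀
        top = + (lam * toℕ k) - ∑ (tops r)
        cancel : ∀ a b → (a +ᶻ b) - b ≡ a
        cancel = solve-∀
        -- The unrecorded leading coefficient comes out right because all of them together add up to
        -- `lam * toℕ k`.
        top≈ : top ≈ d₀
        top≈ = begin
          + (lam * toℕ k) - ∑ (tops r)  ≈⟨ +-cong (≈-sym sum-of-tops) (-‿cong (∑-≈ λ ε →
            ≈-trans (≈-reflexive (cong (rep ∘ proj₂) (table-‼ (λ ε → map res (tail (cᵉ ε)) , res (dᵉ ε)) ε))) (rep-res (dᵉ ε)))) ⟩
          (d₀ +ᶻ ∑ dᵉ) - ∑ dᵉ           ≡⟨ cancel d₀ (∑ dᵉ) ⟩
          d₀                            ∎

      wordᵉ≈ : ∀ ε {i} → i ∈ S → wordᵉ T (c ‼ ε) (r ‼ ε) ε i ≈ yᵉ ε i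
      wordᵉ≈ ε {i} p = begin
        wordᵉ T (c ‼ ε) (r ‼ ε) ε i
          ≡⟨ cong₂ (λ a b → wordᵉ T a b ε i) (table-‼ (λ ε → res (head (cᵉ ε))) ε)
               (table-‼ (λ ε → map res (tail (cᵉ ε)) , res (dᵉ ε)) ε) ⟩
        horner (map rep (res (head (cᵉ ε)) ∷ map res (tail (cᵉ ε)))) (rep (res (dᵉ ε))) (nodes base ε i) +ᶻ shift T ε i
          ≡⟨ cong (λ cs → horner (map rep cs) (rep (res (dᵉ ε))) (nodes base ε i) +ᶻ shift T ε i) (map-head-tail (cᵉ ε)) ⟩
        horner (map rep (map res (cᵉ ε))) (rep (res (dᵉ ε))) (nodes base ε i) +ᶻ shift T ε i
          ≈⟨ +-cong (≈-trans (horner-res (cᵉ ε) (nodes base ε i) (rep-res (dᵉ ε))) (proj₂ (polyᵉ ε) p)) ≈-refl ⟩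
        zᵉ ε i +ᶻ shift T ε i  ≡⟨ cancel (yᵉ ε i) (shift T ε i) ⟩
        yᵉ ε i                 ∎
        where
        open SetoidReasoning ≈-setoid
        cancel : ∀ a b → (a - b) +ᶻ b ≡ a
        cancel = solve-∀

      word≡ : ∀ {i} → i ∈ S → value i ≡ word block i
      word≡ {i} p = cong₂ _,_
        (trans (sym (res-rep _)) (sym (res-cong (word₀≈ p))))
        (table-ext λ ε → trans (trans (sym (res-rep _)) (sym (res-cong (wordᵉ≈ ε p))))
          (sym (table-‼ (λ ε → res (wordᵉ T (c ‼ ε) (r ‼ ε) ε i)) ε)))

    codeCovers : Covers codeBlocks e
    codeCovers = block , λ j → let p = ∈-image⁺ (proj₁ ∘ e) j in
      S⊆T p , trans (sym (value-e j)) (word≡ p)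

-- Binomial coefficients and powers

C-mono : ∀ {a b} k → a ≤ b → a C k ≤ b C k
C-mono {a} k a≤b with ℕₚ.≤⇒≤′ a≤b
... | ℕ.≤′-refl = ℕₚ.≤-refl
... | ℕ.≤′-step {b} p = ℕₚ.≤-trans (C-mono k (ℕₚ.≤′⇒≤ p)) (C-mono-suc b k)

C-positive : ∀ {k n} → k ≤ n → 0 < n C k
C-positive z≤n = s≤s z≤n
C-positive {suc k} {suc n} (s≤s p) = ℕₚ.≤-trans (C-positive p)
  (ℕₚ.≤-trans (ℕₚ.m≤m+n _ _) (ℕₚ.≤-reflexive (nCk+nC[k+1]≡[n+1]C[k+1] n k)))

C*!*! : ∀ x y → ((x + y) C x) * (x ! * y !) ≡ (x + y) !
C*!*! x y = begin
  ((x + y) C x) * (x ! * y !)              ≡⟨ cong (λ z → ((x + y) C x) * (x ! * z !)) (ℕₚ.m+n∸m≡n x y) ⟨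
  ((x + y) C x) * (x ! * (x + y ∸ x) !)    ≡⟨ cong (_* (x ! * (x + y ∸ x) !)) (nCk≡n!/k![n-k]! (ℕₚ.m≤m+n x y)) ⟩
  (x + y) ! / (x ! * (x + y ∸ x) !) * (x ! * (x + y ∸ x) !)
                                           ≡⟨ ℕᵈ.m/n*n≡m (k![n∸k]!∣n! (ℕₚ.m≤m+n x y)) ⟩
  (x + y) !                                ∎
  where
  open ≡-Reasoning
  instance _ = x ℕₚ.!* (x + y ∸ x) !≢0

-- Both sides count pairs of a set of size j + d and a subset of it of size j.
C*C : ∀ j d e → ((j + d + e) C (j + d)) * ((j + d) C j) ≡ ((j + d + e) C j) * ((d + e) C d)
C*C j d e = ℕₚ.*-cancelʳ-≡ _ _ (j ! * (d ! * e !)) (begin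
  A * B * (j ! * (d ! * e !))          ≡⟨ lemma A B (j !) (d !) (e !) ⟩
  A * (B * (j ! * d !) * e !)          ≡⟨ cong (λ z → A * (z * e !)) (C*!*! j d) ⟩
  A * ((j + d) ! * e !)                ≡⟨ C*!*! (j + d) e ⟩
  (j + d + e) !                        ≡⟨ cong _! (ℕₚ.+-assoc j d e) ⟩
  (j + (d + e)) !                      ≡⟨ C*!*! j (d + e) ⟨
  ((j + (d + e)) C j) * (j ! * (d + e) !)  ≡⟨ cong₂ (λ y z → (y C j) * (j ! * z)) (sym (ℕₚ.+-assoc j d e)) (sym (C*!*! d e)) ⟩
  P * (j ! * (Q * (d ! * e !)))        ≡⟨ lemma' P Q (j !) (d ! * e !) ⟩
  P * Q * (j ! * (d ! * e !))          ∎)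
  where
  open ≡-Reasoning
  A = (j + d + e) C (j + d)
  B = (j + d) C j
  P = (j + d + e) C j
  Q = (d + e) C d
  instance
    _ = d ℕₚ.!* e !≢0
    _ = ℕₚ.m*n≢0 (j !) (d ! * e !) {{j ℕₚ.!≢0}}
  lemma : ∀ A B j d e → A * B * (j * (d * e)) ≡ A * (B * (j * d) * e)
  lemma = ℕSolver.solve-∀
  lemma' : ∀ P Q j z → P * (j * (Q * z)) ≡ P * Q * (j * z)
  lemma' = ℕSolver.solve-∀

-- Only the sets with at most one of the `y` new elements are counted.
C-+ : ∀ x y k → (x C suc k) + y * (x C k) ≤ (x + y) C suc k
C-+ x zero k = ℕₚ.≤-reflexive (trans (ℕₚ.+-identityʳ _) (cong (_C suc k) (sym (ℕₚ.+-identityʳ x))))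
C-+ x (suc y) k = begin
  (x C suc k) + (x C k + y * (x C k))    ≡⟨ lemma (x C suc k) (x C k) (y * (x C k)) ⟩
  x C k + ((x C suc k) + y * (x C k))    ≤⟨ ℕₚ.+-mono-≤ (C-mono k (ℕₚ.m≤m+n x y)) (C-+ x y k) ⟩
  (x + y) C k + (x + y) C suc k          ≡⟨ nCk+nC[k+1]≡[n+1]C[k+1] (x + y) k ⟩
  suc (x + y) C suc k                    ≡⟨ cong (_C suc k) (ℕₚ.+-suc x y) ⟨
  (x + suc y) C suc k                    ∎
  where
  open ℕₚ.≤-Reasoning
  lemma : ∀ a b c → a + (b + c) ≡ b + (a + c)
  lemma = ℕSolver.solve-∀

-- The left side counts the k-sets transversal to `a` groups of `y` elements.
C-* : ∀ a y k → (a C k) * y ^ k ≤ (a * y) C k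
C-* a y zero = ℕₚ.≤-refl
C-* zero y (suc k) = z≤n
C-* (suc a) y (suc k) = begin
  (suc a C suc k) * (y * y ^ k)                     ≡⟨ cong (_* (y * y ^ k)) (nCk+nC[k+1]≡[n+1]C[k+1] a k) ⟨
  (a C k + a C suc k) * (y * y ^ k)                 ≡⟨ lemma (a C k) (a C suc k) y (y ^ k) ⟩
  (a C suc k) * (y * y ^ k) + y * ((a C k) * y ^ k) ≤⟨ ℕₚ.+-mono-≤ (C-* a y (suc k)) (ℕₚ.*-monoʳ-≤ y (C-* a y k)) ⟩
  (a * y) C suc k + y * ((a * y) C k)               ≤⟨ C-+ (a * y) y k ⟩
  (a * y + y) C suc k                               ≡⟨ cong (_C suc k) (ℕₚ.+-comm (a * y) y) ⟩
  (suc a * y) C suc k                               ∎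
  where
  open ℕₚ.≤-Reasoning
  lemma : ∀ p q y z → (p + q) * (y * z) ≡ q * (y * z) + y * (p * z)
  lemma = ℕSolver.solve-∀

-- This is (1 + F)^J - 1; what matters is that it does not depend on `M`.
bernoulliConstant : ℕ → ℕ → ℕ
bernoulliConstant F zero = 0
bernoulliConstant F (suc J) = F + bernoulliConstant F J + F * bernoulliConstant F J

-- The bound (1 + F/M)^J ≤ 1 + B/M without denominators, by induction on J; M ≥ 1 absorbs the
-- quadratic term.
bernoulli : ∀ F J M .{{_ : NonZero M}} → M * (M + F) ^ J ≤ M ^ J * (M + bernoulliConstant F J)
bernoulli F zero M = ℕₚ.≤-reflexive (lemma M)
  where
  lemma : ∀ M → M * 1 ≡ 1 * (M + 0)
  lemma = ℕSolver.solve-∀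
bernoulli F (suc J) M = begin
  M * ((M + F) * (M + F) ^ J)               ≡⟨ lemma M (M + F) ((M + F) ^ J) ⟩
  (M + F) * (M * (M + F) ^ J)               ≤⟨ ℕₚ.*-monoʳ-≤ (M + F) (bernoulli F J M) ⟩
  (M + F) * (M ^ J * (M + B))               ≡⟨ lemma₂ M F B (M ^ J) ⟩
  M ^ J * (M * (M + (F + B)) + F * B)       ≤⟨ ℕₚ.*-monoʳ-≤ (M ^ J) (ℕₚ.+-monoʳ-≤ (M * (M + (F + B))) (ℕₚ.m≤n*m (F * B) M)) ⟩
  M ^ J * (M * (M + (F + B)) + M * (F * B)) ≡⟨ lemma₃ M F B (M ^ J) ⟩
  M * M ^ J * (M + (F + B + F * B))         ∎
  where
  open ℕₚ.≤-Reasoning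
  B = bernoulliConstant F J
  lemma : ∀ a b c → a * (b * c) ≡ b * (a * c)
  lemma = ℕSolver.solve-∀
  lemma₂ : ∀ M F B P → (M + F) * (P * (M + B)) ≡ P * (M * (M + (F + B)) + F * B)
  lemma₂ = ℕSolver.solve-∀
  lemma₃ : ∀ M F B P → P * (M * (M + (F + B)) + M * (F * B)) ≡ M * P * (M + (F + B + F * B))
  lemma₃ = ℕSolver.solve-∀

-- For large `M` the ratio of the powers is at most 1 + 1/v.
power-ratio : ∀ v F J M .{{_ : NonZero M}} → v * bernoulliConstant F J ≤ M → v * (M + F) ^ J ≤ suc v * M ^ J
power-ratio v F J M h = ℕₚ.*-cancelˡ-≤ M (begin
  M * (v * (M + F) ^ J)   ≡⟨ lemma M v ((M + F) ^ J) ⟩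
  v * (M * (M + F) ^ J)   ≤⟨ ℕₚ.*-monoʳ-≤ v (bernoulli F J M) ⟩
  v * (M ^ J * (M + B))   ≡⟨ lemma₂ v (M ^ J) M B ⟩
  M ^ J * (v * M + v * B) ≤⟨ ℕₚ.*-monoʳ-≤ (M ^ J) (ℕₚ.+-monoʳ-≤ (v * M) h) ⟩
  M ^ J * (v * M + M)     ≡⟨ lemma₃ v (M ^ J) M ⟩
  M * (suc v * M ^ J)     ∎)
  where
  open ℕₚ.≤-Reasoning
  B = bernoulliConstant F J
  lemma : ∀ a b c → a * (b * c) ≡ b * (a * c)
  lemma = ℕSolver.solve-∀
  lemma₂ : ∀ v P M B → v * (P * (M + B)) ≡ P * (v * M + v * B)
  lemma₂ = ℕSolver.solve-∀
  lemma₃ : ∀ v P M → P * (v * M + M) ≡ M * ((1 + v) * P)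
  lemma₃ = ℕSolver.solve-∀

-- An upward search from `s`, which ends because `r ≤ h (s + r)`.
bracket : ∀ (h : ℕ → ℕ) → (∀ x → x ≤ h x) → ∀ s r → h s < r → ∃ λ x → s ≤ x × h x < r × r ≤ h (suc x)
bracket h grows s r hs<r = go r s hs<r (ℕₚ.≤-trans (ℕₚ.m≤m+n r s) (ℕₚ.≤-trans (ℕₚ.≤-reflexive (ℕₚ.+-comm r s)) (grows (s + r))))
  where
  go : ∀ d s → h s < r → r ≤ h (s + d) → ∃ λ x → s ≤ x × h x < r × r ≤ h (suc x)
  go zero s lt le = ⊥-elim (ℕₚ.<⇒≱ lt (subst (λ z → r ≤ h z) (ℕₚ.+-identityʳ s) le))
  go (suc d) s lt le with r ℕₚ.≤? h (suc s)
  ... | yes p = s , ℕₚ.≤-refl , lt , p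
  ... | no ¬p with go d (suc s) (ℕₚ.≰⇒> ¬p) (subst (λ z → r ≤ h z) (ℕₚ.+-suc s d) le)
  ... | x , p , q = x , ℕₚ.<⇒≤ p , q

-- The choice of the modulus

module Nodes (n s : ℕ) where

  -- In the progression 1 + F s every positive integer up to 2n is invertible, and the consecutive
  -- moduli `M` and `N` differ by the fixed amount `F`, so their ratio tends to 1.
  F M N : ℕ
  F = (2 * n) !
  M = suc (F * s)
  N = M + F

  open Modular N

  -- d * (F / d) = F and N = 1 + F * (1 + s).
  inv : ℤ → ℤ
  inv (+ suc d) = - (+ (F / suc d * suc s))
  inv _ = 0ℤ

  inv-inverse : ∀ d → suc d ≤ 2 * n → + suc d *ᶻ inv (+ suc d) ≈ 1ℤ
  inv-inverse d d< = congruent (- 1ℤ) (trans (sym (ℤₚ.neg-distribʳ-* (+ suc d) (+ (F / suc d * suc s))))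
    (trans (cong -_ (trans (sym (ℤₚ.pos-* (suc d) _)) (cong +_ product))) (trans (lemma (+ (F * suc s)))
      (cong (λ z → 1ℤ +ᶻ (- 1ℤ) *ᶻ + z) (sym (lemma' F s))))))
    where
    product : suc d * (F / suc d * suc s) ≡ F * suc s
    product = trans (sym (ℕₚ.*-assoc (suc d) (F / suc d) (suc s)))
      (cong (_* suc s) (ℕᵈ.m*[n/m]≡n (∣-trans (m∣m*n (d !)) (m≤n⇒m!∣n! d<))))
    lemma : ∀ z → - z ≡ 1ℤ +ᶻ (- 1ℤ) *ᶻ (1ℤ +ᶻ z)
    lemma = solve-∀
    lemma' : ∀ F s → (1 + F * s) + F ≡ 1 + F * (1 + s)
    lemma' = ℕSolver.solve-∀

  base : Fin n → ℤ
  base i = + (2 * toℕ i)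

  base-regular : Isolation.CubeRegular N inv base
  base-regular {i} {j} i<j a b = subst (λ z → z *ᶻ inv z ≈ 1ℤ) (sym difference) (inv-inverse d d<)
    where
    e = toℕ j ∸ suc (toℕ i)
    toℕ-j : toℕ j ≡ suc (toℕ i) + e
    toℕ-j = sym (ℕₚ.m+[n∸m]≡n i<j)
    bitℕ : Bool → ℕ
    bitℕ false = 0
    bitℕ true = 1
    bit≡ : ∀ b → bit b ≡ + bitℕ b
    bit≡ false = refl
    bit≡ true = refl
    bitℕ≤1 : ∀ b → bitℕ b ≤ 1
    bitℕ≤1 false = z≤n
    bitℕ≤1 true = ℕₚ.≤-refl
    -- For j = i + 1 + e the difference of the nodes is 2(e + 1) + b - a, which is 1 + d without
    -- subtracting `a`.
    d : ℕ
    d = 2 * e + bitℕ b + (1 ∸ bitℕ a)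
    difference : (base j +ᶻ bit b) - (base i +ᶻ bit a) ≡ + suc d
    difference = trans (cong₂ (λ x y → (base j +ᶻ x) - (base i +ᶻ y)) (bit≡ b) (bit≡ a))
      (trans (cong (λ z → + z - + (2 * toℕ i + bitℕ a)) split) (cancel (+ (2 * toℕ i + bitℕ a)) (+ suc d)))
      where
      cancel : ∀ y d → (y +ᶻ d) - y ≡ d
      cancel = solve-∀
      lemma₁ : ∀ i e b → 2 * (1 + i + e) + b ≡ 1 + 1 + (2 * i + 2 * e + b)
      lemma₁ = ℕSolver.solve-∀
      lemma₂ : ∀ i e b a a' → 1 + (a + a') + (2 * i + 2 * e + b) ≡ 2 * i + a + (1 + (2 * e + b + a'))
      lemma₂ = ℕSolver.solve-∀
      split : 2 * toℕ j + bitℕ b ≡ (2 * toℕ i + bitℕ a) + suc d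
      split = trans (cong (λ z → 2 * z + bitℕ b) toℕ-j) (trans (lemma₁ (toℕ i) e (bitℕ b))
        (trans (cong (λ z → suc z + (2 * toℕ i + 2 * e + bitℕ b)) (sym (ℕₚ.m+[n∸m]≡n (bitℕ≤1 a))))
          (lemma₂ (toℕ i) e (bitℕ b) (bitℕ a) (1 ∸ bitℕ a))))
    d< : suc d ≤ 2 * n
    d< = begin
      suc (2 * e + bitℕ b + (1 ∸ bitℕ a)) ≤⟨ s≤s (ℕₚ.+-mono-≤ (ℕₚ.+-monoʳ-≤ (2 * e) (bitℕ≤1 b)) (ℕₚ.m∸n≤m 1 (bitℕ a))) ⟩
      suc (2 * e + 1 + 1)                 ≤⟨ ℕₚ.m≤m+n _ (1 + 2 * toℕ i) ⟩
      suc (2 * e + 1 + 1) + (1 + 2 * toℕ i) ≡⟨ lemma e (toℕ i) ⟩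
      2 * suc (suc (toℕ i) + e)           ≡⟨ cong (λ z → 2 * suc z) toℕ-j ⟨
      2 * suc (toℕ j)                     ≤⟨ ℕₚ.*-monoʳ-≤ 2 (Finₚ.toℕ<n j) ⟩
      2 * n                               ∎
      where
      open ℕₚ.≤-Reasoning
      lemma : ∀ e i → 1 + (2 * e + 1 + 1) + (1 + 2 * i) ≡ 2 * (1 + (1 + i + e))
      lemma = ℕSolver.solve-∀

infix 4 _↩_
-- The counterpart of `↪`: a supply of k distinct elements, in which the r parts find their points.
_↩_ : Set → ℕ → Set
A ↩ k = Σ (Fin k → A) (Injective _≡_ _≡_)

infixr 3 _×↩_
_×↩_ : ∀ {A B a b} → A ↩ a → B ↩ b → (A × B) ↩ (a * b)
_×↩_ {a = a} {b} (f , fi) (g , gi) = (λ z → let x , y = Fin.remQuot {a} b z in f x , g y) , λ {z} {z'} eq →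
  let p , q = ,-injective eq in trans (sym (Finₚ.combine-remQuot {a} b z))
    (trans (cong₂ Fin.combine (fi p) (gi q)) (Finₚ.combine-remQuot {a} b z'))

table↩ : ∀ n {A a} → A ↩ a → Table A n ↩ (a ^ (2 ^ n))
table↩ zero {a = a} (f , fi) = subst (Table _ zero ↩_) (sym (ℕₚ.*-identityʳ a))
  ((λ x → leaf (f x)) , λ eq → fi (cong (λ { (leaf x) → x }) eq))
table↩ (suc n) {a = a} e = let f , fi = table↩ n e ×↩ table↩ n e in subst (Table _ (suc n) ↩_)
  (trans (sym (ℕₚ.^-distribˡ-+-* a (2 ^ n) (2 ^ n))) (cong (λ k → a ^ (2 ^ n + k)) (sym (ℕₚ.+-identityʳ _))))
  ((λ x → let y , z = f x in fork y z) , λ eq → fi (cong (λ { (fork y z) → y , z }) eq))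

-- The hypergraph

*-^ : ∀ a b k → (a * b) ^ k ≡ a ^ k * b ^ k
*-^ a b zero = refl
*-^ a b (suc k) = trans (cong (a * b *_) (*-^ a b k)) (lemma a b (a ^ k) (b ^ k))
  where
  lemma : ∀ a b c d → a * b * (c * d) ≡ a * c * (b * d)
  lemma = ℕSolver.solve-∀

-- In units of 1/(4q), the factor grows from 4q to 4q + 1 by the bent blocks, to 4q + 2 by rounding
-- N / lam up, and to 4q + 3 by passing from `N` to `M`; the conclusion allows 4q + 4.
combine-bounds : ∀ {q c c₀ lam E N A K k₂ P Q} →
  A * c ≤ c₀ * lam → lam * K ≤ N + lam → 4 * q * k₂ * c ≤ c₀ * (E * N) → 4 * q * lam ≤ N →
  (4 * q + 2) * (E * N) ≤ (4 * q + 3) * P → c₀ * P ≤ Q →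
  q * (A * (E * K) + k₂) * c ≤ (q + 1) * Q
combine-bounds {q} {c} {c₀} {lam} {E} {N} {A} {K} {k₂} {P} {Q} h₁ h₂ h₃ h₄ h₅ h₆ = ℕₚ.*-cancelˡ-≤ 4 (begin
  4 * (q * (A * (E * K) + k₂) * c)                                ≡⟨ lemma₁ q A E K k₂ c ⟩
  4 * q * E * K * (A * c) + 4 * q * k₂ * c                        ≤⟨ ℕₚ.+-mono-≤ (ℕₚ.*-monoʳ-≤ (4 * q * E * K) h₁) h₃ ⟩
  4 * q * E * K * (c₀ * lam) + c₀ * (E * N)                       ≡⟨ lemma₂ q E K c₀ lam (c₀ * (E * N)) ⟩
  4 * q * E * c₀ * (lam * K) + c₀ * (E * N)                       ≤⟨ ℕₚ.+-monoˡ-≤ (c₀ * (E * N)) (ℕₚ.*-monoʳ-≤ (4 * q * E * c₀) h₂) ⟩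
  4 * q * E * c₀ * (N + lam) + c₀ * (E * N)                       ≡⟨ lemma₃ q E c₀ N lam ⟩
  (4 * q + 1) * (c₀ * (E * N)) + c₀ * E * (4 * q * lam)           ≤⟨ ℕₚ.+-monoʳ-≤ ((4 * q + 1) * (c₀ * (E * N))) (ℕₚ.*-monoʳ-≤ (c₀ * E) h₄) ⟩
  (4 * q + 1) * (c₀ * (E * N)) + c₀ * E * N                       ≡⟨ lemma₄ q c₀ E N ⟩
  c₀ * ((4 * q + 2) * (E * N))                                    ≤⟨ ℕₚ.*-monoʳ-≤ c₀ h₅ ⟩
  c₀ * ((4 * q + 3) * P)                                          ≡⟨ lemma₅ c₀ q P ⟩
  (4 * q + 3) * (c₀ * P)                                          ≤⟨ ℕₚ.*-mono-≤ (ℕₚ.+-monoʳ-≤ (4 * q) (ℕₚ.n≤1+n 3)) h₆ ⟩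
  (4 * q + 4) * Q                                                 ≡⟨ lemma₆ q Q ⟩
  4 * ((q + 1) * Q)                                               ∎)
  where
  open ℕₚ.≤-Reasoning
  lemma₁ : ∀ q A E K k c → 4 * (q * (A * (E * K) + k) * c) ≡ 4 * q * E * K * (A * c) + 4 * q * k * c
  lemma₁ = ℕSolver.solve-∀
  lemma₂ : ∀ q E K c l z → 4 * q * E * K * (c * l) + z ≡ 4 * q * E * c * (l * K) + z
  lemma₂ = ℕSolver.solve-∀
  lemma₃ : ∀ q E c N l → 4 * q * E * c * (N + l) + c * (E * N) ≡ (4 * q + 1) * (c * (E * N)) + c * E * (4 * q * l)
  lemma₃ = ℕSolver.solve-∀
  lemma₄ : ∀ q c E N → (4 * q + 1) * (c * (E * N)) + c * E * N ≡ c * ((4 * q + 2) * (E * N))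
  lemma₄ = ℕSolver.solve-∀
  lemma₅ : ∀ c q P → c * ((4 * q + 3) * P) ≡ (4 * q + 3) * (c * P)
  lemma₅ = ℕSolver.solve-∀
  lemma₆ : ∀ q Q → (4 * q + 4) * Q ≡ 4 * ((q + 1) * Q)
  lemma₆ = ℕSolver.solve-∀

-- The first summand of `b` makes the bent codes negligible, the summand `t` ensures t ≤ n, and n -
-- 1 = (m - 1) b gives b^(m-1) ≤ C(n-1, m-1). As variables with equations, the three numbers stay
-- unreduced.
module Construction (t m' q : ℕ) (m≤t : suc (suc m') ≤ t) (b n lam : ℕ)
  (b-def : b ≡ 4 * q * (suc (suc m') * suc (suc m') ^ m' * ((t ∸ 1) C suc m')) + t)
  (n-def : n ≡ suc (suc m' * b))
  (lam-def : lam ≡ (n ∸ suc (suc m')) C (t ∸ suc (suc m'))) where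

  m j c L F : ℕ
  m = suc (suc m')
  j = suc m'
  c = (t ∸ 1) C j
  L = suc (2 ^ n)
  F = (2 * n) !

  -- The number of points, n groups of words with `L` letters, for the modulus 1 + F s.
  size : ℕ → ℕ
  size s = n * suc (F * s) ^ L

  -- The first summand makes `lam` at most N / (4q); the second is the threshold of `power-ratio`
  -- for v = 4q + 2.
  s₀ : ℕ
  s₀ = 4 * q * lam + (4 * q + 2) * bernoulliConstant F (L * j)

  t≤b : t ≤ b
  t≤b = subst (t ≤_) (sym b-def) (ℕₚ.m≤n+m t _)

  t≤n : t ≤ n
  t≤n = subst (t ≤_) (sym n-def) (ℕₚ.≤-trans t≤b (ℕₚ.≤-trans (ℕₚ.m≤n*m b j) (ℕₚ.n≤1+n _)))

  1≤b : 1 ≤ b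
  1≤b = ℕₚ.≤-trans (ℕₚ.≤-trans (s≤s z≤n) m≤t) t≤b

  private instance
    lam-nonZero : NonZero lam
    lam-nonZero = ℕ.>-nonZero (subst (0 <_) (sym lam-def) (C-positive (ℕₚ.∸-monoˡ-≤ m t≤n)))

    n-nonZero : NonZero n
    n-nonZero = subst NonZero (sym n-def) _

  size-grows : ∀ x → x ≤ size x
  size-grows x = begin
    x                    ≤⟨ ℕₚ.m≤n*m x F ⟩
    F * x                ≤⟨ ℕₚ.n≤1+n _ ⟩
    suc (F * x)          ≡⟨ ℕₚ.^-identityʳ _ ⟨
    suc (F * x) ^ 1      ≤⟨ ℕₚ.^-monoʳ-≤ (suc (F * x)) {1} {L} (s≤s z≤n) ⟩
    suc (F * x) ^ L      ≤⟨ ℕₚ.m≤n*m _ n ⟩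
    size x               ∎
    where
    open ℕₚ.≤-Reasoning
    instance _ = (2 * n) ℕₚ.!≢0

  module _ (r s : ℕ) (s₀≤s : s₀ ≤ s) (size< : size s < r) (r≤size : r ≤ size (suc s)) where
    open Nodes n s using (N; M; inv; base; base-regular)

    K : ℕ
    K = suc (N / lam)

    open CodeBlocks N inv base base-regular t m' lam K m≤t lam-def (λ w<N → s≤s (ℕᵈ./-monoˡ-≤ lam (ℕₚ.<⇒≤ w<N)))
      using (Y; Code; codeBlocks; codeCovers)
    open Bent {n} {Y} (≡-dec Fin._≟_ (table-≟ Fin._≟_)) {t} {m'} m≤t using (X; BentCode; bentBlocks; bentCovers)

    y : ℕ
    y = N * N ^ (2 ^ n)

    Y↪ : Y ↪ y
    Y↪ = fin↪ ×↪ table↪ n fin↪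

    X↩ : X ↩ (n * y)
    X↩ = (id , id) ×↩ (id , id) ×↩ table↩ n (id , id)

    k₁ k₂ k : ℕ
    k₁ = ((n ∸ 1) C (t ∸ 1)) * (N ^ m' * ((N ^ m' * N) ^ (2 ^ n) * K))
    k₂ = suc m' * ((n * y) ^ m' * y) + (n * y) ^ m' * y
    k = k₁ + k₂

    codes↪ : (Code ⊎ BentCode) ↪ k
    codes↪ = (fin↪ ×↪ vec↪ fin↪ m' ×↪ table↪ n (vec↪ fin↪ m' ×↪ fin↪) ×↪ fin↪) ⊎↪
      ((fin↪ ×↪ vec↪ (fin↪ ×↪ Y↪) m' ×↪ Y↪) ⊎↪ (vec↪ (fin↪ ×↪ Y↪) m' ×↪ Y↪))

    blocks : Blocks X t (Code ⊎ BentCode)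
    blocks = codeBlocks ∪ᴮ bentBlocks

    covers : ∀ (e : Fin m → X) → Injective _≡_ _≡_ e → Covers blocks e
    covers e _ with Finₚ.any? (λ i → Finₚ.any? λ i' → ¬? (i Fin.≟ i') ×-dec (proj₁ (e i) Fin.≟ proj₁ (e i')))
    ... | yes (i , i' , i≢i' , eq) = let β , p = bentCovers e i i' i≢i' eq in inj₂ β , p
    ... | no ¬p = let β , p = codeCovers e transversal in inj₁ β , p
      where
      transversal : Injective _≡_ _≡_ (proj₁ ∘ e)
      transversal {i} {i'} eq with i Fin.≟ i'
      ... | yes i≡i' = i≡i'
      ... | no i≢i' = ⊥-elim (¬p (i , i' , i≢i' , eq))

    r≤X : r ≤ n * y
    r≤X = ℕₚ.≤-trans r≤size (ℕₚ.≤-reflexive (cong (λ z → n * z ^ L) (lemma F s)))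
      where
      lemma : ∀ F s → 1 + F * (1 + s) ≡ 1 + F * s + F
      lemma = ℕSolver.solve-∀

    embed : Fin r → X
    embed i = proj₁ X↩ (Fin.inject≤ i r≤X)

    embed-inj : Injective _≡_ _≡_ embed
    embed-inj eq = Finₚ.inject≤-injective r≤X r≤X _ _ (proj₂ X↩ eq)

    graph : (𝓗 : Hypergraph m → Set) → (∀ F → 𝓗 F → Connected F × t < nV F) →
      Σ (Hypergraph m) λ G → IsRK r k G × Free 𝓗 G
    graph 𝓗 big = blockGraph 2≤m m≤t codes↪ 𝓑 covers' , blockGraph-IsRK 2≤m m≤t codes↪ 𝓑 covers' ,
      blockGraph-Free 2≤m m≤t codes↪ 𝓑 covers' 𝓗 big
      where
      2≤m : 2 ≤ m
      2≤m = s≤s (s≤s z≤n)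
      𝓑 = restrict embed embed-inj blocks
      covers' : ∀ (e : Fin m → Fin r) → Injective _≡_ _≡_ e → Covers 𝓑 e
      covers' e e-inj = covers (embed ∘ e) (e-inj ∘ embed-inj)

    -- Counting the codes

    E c₀ A : ℕ
    E = N ^ m' * (N ^ m' * N) ^ (2 ^ n)
    c₀ = (n ∸ 1) C j
    A = (n ∸ 1) C (t ∸ 1)

    -- `E` counts m - 1 coefficients for each letter, except the leading one of the additional
    -- letter; the factor `N` restores it.
    EN≡ : E * N ≡ y ^ j
    EN≡ = begin
      N ^ m' * (N ^ m' * N) ^ (2 ^ n) * N     ≡⟨ cong (λ z → N ^ m' * z ^ (2 ^ n) * N) (ℕₚ.*-comm (N ^ m') N) ⟩
      N ^ m' * (N ^ j) ^ (2 ^ n) * N          ≡⟨ cong (λ z → N ^ m' * z * N) (swap j) ⟩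
      N ^ m' * (N ^ (2 ^ n)) ^ j * N          ≡⟨ lemma (N ^ m') ((N ^ (2 ^ n)) ^ j) N ⟩
      N ^ j * (N ^ (2 ^ n)) ^ j               ≡⟨ *-^ N (N ^ (2 ^ n)) j ⟨
      y ^ j                                   ∎
      where
      open ≡-Reasoning
      lemma : ∀ a b c → a * b * c ≡ c * a * b
      lemma = ℕSolver.solve-∀
      swap : ∀ k → (N ^ k) ^ (2 ^ n) ≡ (N ^ (2 ^ n)) ^ k
      swap k = trans (ℕₚ.^-*-assoc N k (2 ^ n)) (trans (cong (N ^_) (ℕₚ.*-comm k (2 ^ n))) (sym (ℕₚ.^-*-assoc N (2 ^ n) k)))

    s≤M : s ≤ M
    s≤M = ℕₚ.≤-trans (ℕₚ.m≤n*m s F) (ℕₚ.n≤1+n _)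
      where instance _ = (2 * n) ℕₚ.!≢0

    A*c≤ : A * c ≤ c₀ * lam
    A*c≤ = ℕₚ.≤-reflexive (begin
      ((n ∸ 1) C (t ∸ 1)) * ((t ∸ 1) C j)    ≡⟨ cong₂ (λ u v → (u C v) * (v C j)) n∸1≡ t≡ ⟩
      ((j + d + e) C (j + d)) * ((j + d) C j) ≡⟨ C*C j d e ⟩
      ((j + d + e) C j) * ((d + e) C d)      ≡⟨ cong₂ (λ u v → (u C j) * v) (sym n∸1≡) (trans (cong (_C d) (sym n∸m≡)) (sym lam-def)) ⟩
      c₀ * lam                               ∎)
      where
      open ≡-Reasoning
      d = t ∸ m
      e = n ∸ t
      t≡ : t ∸ 1 ≡ j + d
      t≡ = cong (_∸ 1) (sym (ℕₚ.m+[n∸m]≡n m≤t))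
      n∸1≡ : n ∸ 1 ≡ j + d + e
      n∸1≡ = cong (_∸ 1) (trans (sym (ℕₚ.m+[n∸m]≡n t≤n)) (cong (_+ e) (sym (ℕₚ.m+[n∸m]≡n m≤t))))
      n∸m≡ : n ∸ m ≡ d + e
      n∸m≡ = trans (trans (sym (ℕₚ.∸-+-assoc n 1 j)) (cong (_∸ j) n∸1≡)) (trans (cong (_∸ j) (ℕₚ.+-assoc j d e)) (ℕₚ.m+n∸m≡n j (d + e)))

    lam*K≤ : lam * K ≤ N + lam
    lam*K≤ = begin
      lam * suc (N / lam)   ≡⟨ ℕₚ.*-suc lam (N / lam) ⟩
      lam + lam * (N / lam) ≡⟨ cong (λ z → lam + z) (ℕₚ.*-comm lam (N / lam)) ⟩
      lam + N / lam * lam   ≤⟨ ℕₚ.+-monoʳ-≤ lam (ℕᵈ.m/n*n≤m N lam) ⟩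
      lam + N               ≡⟨ ℕₚ.+-comm lam N ⟩
      N + lam               ∎
      where open ℕₚ.≤-Reasoning

    -- There are m n^(m-2) y^(m-1) bent codes. With n ≤ m b, the constant 4q m^(m-1) c is absorbed
    -- by one more factor `b`, and b^(m-1) ≤ `c₀`.
    k₂-bound : 4 * q * k₂ * c ≤ c₀ * (E * N)
    k₂-bound = begin
      4 * q * k₂ * c                              ≡⟨ cong (λ z → 4 * q * (suc m' * (z * y) + z * y) * c) (*-^ n y m') ⟩
      4 * q * (suc m' * (n ^ m' * y ^ m' * y) + n ^ m' * y ^ m' * y) * c
                                                  ≡⟨ lemma q m' (n ^ m') (y ^ m') y c ⟩
      n ^ m' * (4 * q * (m * c)) * y ^ j          ≤⟨ ℕₚ.*-monoˡ-≤ (y ^ j) (ℕₚ.*-monoˡ-≤ (4 * q * (m * c)) (ℕₚ.^-monoˡ-≤ m' n≤m*b)) ⟩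
      (m * b) ^ m' * (4 * q * (m * c)) * y ^ j    ≡⟨ cong (λ z → z * (4 * q * (m * c)) * y ^ j) (*-^ m b m') ⟩
      m ^ m' * b ^ m' * (4 * q * (m * c)) * y ^ j ≡⟨ lemma₂ (m ^ m') (b ^ m') q m c (y ^ j) ⟩
      4 * q * (m * m ^ m' * c) * b ^ m' * y ^ j   ≤⟨ ℕₚ.*-monoˡ-≤ (y ^ j) (ℕₚ.*-monoˡ-≤ (b ^ m') (subst (4 * q * (m * m ^ m' * c) ≤_) (sym b-def) (ℕₚ.m≤m+n _ t))) ⟩
      b ^ j * y ^ j                               ≤⟨ ℕₚ.*-monoˡ-≤ (y ^ j) b^j≤ ⟩
      c₀ * y ^ j                                  ≡⟨ cong (c₀ *_) EN≡ ⟨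
      c₀ * (E * N)                                ∎
      where
      open ℕₚ.≤-Reasoning
      lemma : ∀ q m' N Y y c → 4 * q * ((1 + m') * (N * Y * y) + N * Y * y) * c ≡ N * (4 * q * ((2 + m') * c)) * (y * Y)
      lemma = ℕSolver.solve-∀
      lemma₂ : ∀ M B q m c Z → M * B * (4 * q * (m * c)) * Z ≡ 4 * q * (m * M * c) * B * Z
      lemma₂ = ℕSolver.solve-∀
      n≤m*b : n ≤ m * b
      n≤m*b = subst (_≤ m * b) (sym n-def) (ℕₚ.+-monoˡ-≤ (j * b) 1≤b)
      b^j≤ : b ^ j ≤ c₀
      b^j≤ = ℕₚ.≤-trans (ℕₚ.≤-reflexive (trans (sym (ℕₚ.*-identityˡ (b ^ j))) (cong (_* b ^ j) (sym (nCn≡1 j)))))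
        (ℕₚ.≤-trans (C-* j b j) (ℕₚ.≤-reflexive (cong (λ z → (z ∸ 1) C j) (sym n-def))))

    power-bound : (4 * q + 2) * (E * N) ≤ (4 * q + 3) * (M ^ L) ^ j
    power-bound = begin
      (4 * q + 2) * (E * N)           ≡⟨ cong ((4 * q + 2) *_) (trans EN≡ (ℕₚ.^-*-assoc N L j)) ⟩
      (4 * q + 2) * (M + F) ^ (L * j) ≤⟨ power-ratio (4 * q + 2) F (L * j) M (ℕₚ.≤-trans (ℕₚ.m≤n+m _ (4 * q * lam)) (ℕₚ.≤-trans s₀≤s s≤M)) ⟩
      suc (4 * q + 2) * M ^ (L * j)   ≡⟨ cong₂ _*_ (sym (ℕₚ.+-suc (4 * q) 2)) (sym (ℕₚ.^-*-assoc M L j)) ⟩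
      (4 * q + 3) * (M ^ L) ^ j       ∎
      where open ℕₚ.≤-Reasoning

    -- Since n M^L is less than `r`, the n groups of M^L points fit into r - 1 elements, and `C-*`
    -- counts transversal sets.
    r-bound : c₀ * (M ^ L) ^ j ≤ (r ∸ 1) C j
    r-bound = begin
      c₀ * (M ^ L) ^ j       ≤⟨ ℕₚ.*-monoˡ-≤ ((M ^ L) ^ j) (C-mono j (ℕₚ.m∸n≤m n 1)) ⟩
      (n C j) * (M ^ L) ^ j  ≤⟨ C-* n (M ^ L) j ⟩
      (n * M ^ L) C j        ≤⟨ C-mono j (ℕₚ.∸-monoˡ-≤ 1 size<) ⟩
      (r ∸ 1) C j            ∎
      where open ℕₚ.≤-Reasoning

    k-bound : q * k * c ≤ (q + 1) * ((r ∸ 1) C j)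
    k-bound = begin
      q * k * c                        ≡⟨ cong (λ z → q * (A * z + k₂) * c) (sym (ℕₚ.*-assoc (N ^ m') _ K)) ⟩
      q * (A * (E * K) + k₂) * c       ≤⟨ combine-bounds {q} {c} {c₀} {lam} {E} {N} {A} {K} {k₂} {(M ^ L) ^ j}
        A*c≤ lam*K≤ k₂-bound 4qlam≤N power-bound r-bound ⟩
      (q + 1) * ((r ∸ 1) C j)          ∎
      where
      open ℕₚ.≤-Reasoning
      4qlam≤N : 4 * q * lam ≤ N
      4qlam≤N = ℕₚ.≤-trans (ℕₚ.m≤m+n _ _) (ℕₚ.≤-trans s₀≤s (ℕₚ.≤-trans s≤M (ℕₚ.m≤m+n M F)))

-- The 1 + o(1) is read as: for every `q`, the factor 1 + 1/q suffices for all large `r`, with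
-- denominators cleared.
theorem1p9 : (t m : ℕ) → 2 ≤ m → m ≤ t →
    (𝓗 : Hypergraph m → Set) →
    (∀ F → 𝓗 F → Connected F × t < nV F) →
    ∀ (q : ℕ) → 1 ≤ q → ∃ λ (R : ℕ) → ∀ (r : ℕ) → R ≤ r → m ≤ r →
    ∃ λ (k : ℕ) → (Σ (Hypergraph m) λ G → IsRK r k G × Free 𝓗 G) ×
    q * k * ((t ∸ 1) C (m ∸ 1)) ≤ (q + 1) * ((r ∸ 1) C (m ∸ 1))
theorem1p9 t (suc zero) (s≤s ())
-- Beyond `size s₀` the search of `bracket` can start at `s₀`, which places `r` between the sizes
-- for two consecutive moduli.
theorem1p9 t (suc (suc m')) _ m≤t 𝓗 big q _ = suc (size s₀) , λ r R≤r _ →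
  let s , s₀≤s , size< , r≤size = bracket size size-grows s₀ r R≤r
  in k r s s₀≤s size< r≤size , graph r s s₀≤s size< r≤size 𝓗 big , k-bound r s s₀≤s size< r≤size
  where open Construction t m' q m≤t _ _ _ refl refl refl
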